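{- There is an algorithm that, given a 2-SAT formula $\Phi$ (a CNF formula each of whose clauses has at most two literals) and an integer $k$, decides whether there is a set of at most $k$ clauses of $\Phi$ whose deletion makes $\Phi$ satisfiable, in time $O^*(4^k)$.
   Context: $O^*(\cdot)$ suppresses factors polynomial in the input size. -}

module Defs where

open import Data.Bool.Base using (Bool; true; false)
open import Data.Fin.Base using (Fin)
open import Data.Fin.Subset using (Subset; inside; outside; ∣_∣)
open import Data.Integer.Base as ℤ using (ℤ; +_; -[1+_])
open import Data.List.Base using (List; []; _∷_; length)
open import Data.List.Relation.Unary.All using (All)
open import Data.List.Relation.Unary.Any using (Any)
open import Data.Nat.Base using (ℕ; suc; _+_; _≤_)
open import Data.Nat.Binary.Base as ℕᵇ using (ℕᵇ; 2[1+_]; 1+[2_])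
open import Data.Product.Base using (_×_; _,_; ∃-syntax)
open import Data.Vec.Base using (Vec; []; _∷_; lookup)
open import Relation.Binary.PropositionalEquality.Core using (_≡_; refl)

------------------------------------------------------------------------
-- CNF formulas and clause deletion

data Literal : Set where
  pos neg : (x : ℕ) → Literal

Clause : Set
Clause = List Literal

-- A list, so a clause may occur several times; each occurrence counts
-- separately when it is deleted.
CNF : Set
CNF = List Clause

Is2CNF : CNF → Set
Is2CNF = All (λ C → length C ≤ 2)

Assignment : Set
Assignment = ℕ → Bool

TrueLiteral : Assignment → Literal → Set
TrueLiteral α (pos x) = α x ≡ true
TrueLiteral α (neg x) = α x ≡ false

Satisfiable : CNF → Set
Satisfiable Φ = ∃[ α ] All (Any (TrueLiteral α)) Φ

delete : (Φ : CNF) → Subset (length Φ) → CNF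
delete []      []            = []
delete (C ∷ Φ) (inside  ∷ S) = delete Φ S
delete (C ∷ Φ) (outside ∷ S) = C ∷ delete Φ S

SatisfiableByDeleting : CNF → ℤ → Set
SatisfiableByDeleting Φ k =
  ∃[ S ] + ∣ S ∣ ℤ.≤ k × Satisfiable (delete Φ S)

------------------------------------------------------------------------
-- Model of computation
--
-- A first-order call-by-value language of recursive functions on binary
-- trees, as in Jones, "Computability and Complexity from a Programming
-- Perspective".  Trees are immutable and hence shared, so every rule of
-- the semantics below is a constant number of pointer operations on a
-- RAM; conversely a RAM is simulated by keeping its memory in a balanced
-- tree, with overhead per step polynomial in the word length.  Therefore
-- O*(4^k) time means the same here as on a RAM.

data Tree : Set where
  nil  : Tree
  cons : (l r : Tree) → Tree

size : Tree → ℕ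
size nil        = 1
size (cons l r) = 1 + size l + size r

-- Expressions over n function names with m variables in scope (de Bruijn
-- indices, innermost binder first).
data Expr (n m : ℕ) : Set where
  var    : (x : Fin m) → Expr n m
  nil    : Expr n m
  cons   : (e₁ e₂ : Expr n m) → Expr n m
  letIn  : (e₁ : Expr n m) (e₂ : Expr n (suc m)) → Expr n m
  caseOf : (e : Expr n m) (eₙ : Expr n m) (e꜀ : Expr n (suc (suc m))) → Expr n m
  call   : (f : Fin n) (e : Expr n m) → Expr n m

-- Finitely many mutually recursive unary functions and a main expression
-- whose only variable is the input.
record Program : Set where
  field
    {count} : ℕ
    bodies  : Vec (Expr count 1) count
    main    : Expr count 1

-- bodies ∣ ρ ⊢ e ⇓ v ∶ t : in environment ρ, the expression e evaluates
-- to v in t steps.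
infix 4 _∣_⊢_⇓_∶_

data _∣_⊢_⇓_∶_ {n} (F : Vec (Expr n 1) n) {m} (ρ : Vec Tree m) :
               Expr n m → Tree → ℕ → Set where
  ⇓var : ∀ {x} → F ∣ ρ ⊢ var x ⇓ lookup ρ x ∶ 1

  ⇓nil : F ∣ ρ ⊢ nil ⇓ nil ∶ 1

  ⇓cons : ∀ {e₁ e₂ v₁ v₂ t₁ t₂} →
          F ∣ ρ ⊢ e₁ ⇓ v₁ ∶ t₁ →
          F ∣ ρ ⊢ e₂ ⇓ v₂ ∶ t₂ →
          F ∣ ρ ⊢ cons e₁ e₂ ⇓ cons v₁ v₂ ∶ suc (t₁ + t₂)

  ⇓let : ∀ {e₁ e₂ v₁ v₂ t₁ t₂} →
         F ∣ ρ ⊢ e₁ ⇓ v₁ ∶ t₁ →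
         F ∣ v₁ ∷ ρ ⊢ e₂ ⇓ v₂ ∶ t₂ →
         F ∣ ρ ⊢ letIn e₁ e₂ ⇓ v₂ ∶ suc (t₁ + t₂)

  ⇓case-nil : ∀ {e eₙ e꜀ v t₁ t₂} →
              F ∣ ρ ⊢ e ⇓ nil ∶ t₁ →
              F ∣ ρ ⊢ eₙ ⇓ v ∶ t₂ →
              F ∣ ρ ⊢ caseOf e eₙ e꜀ ⇓ v ∶ suc (t₁ + t₂)

  ⇓case-cons : ∀ {e eₙ e꜀ l r v t₁ t₂} →
               F ∣ ρ ⊢ e ⇓ cons l r ∶ t₁ →
               F ∣ l ∷ r ∷ ρ ⊢ e꜀ ⇓ v ∶ t₂ →
               F ∣ ρ ⊢ caseOf e eₙ e꜀ ⇓ v ∶ suc (t₁ + t₂)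

  ⇓call : ∀ {f e u v t₁ t₂} →
          F ∣ ρ ⊢ e ⇓ u ∶ t₁ →
          F ∣ u ∷ [] ⊢ lookup F f ⇓ v ∶ t₂ →
          F ∣ ρ ⊢ call f e ⇓ v ∶ suc (t₁ + t₂)

-- P on w returns v in t steps.
Run : Program → Tree → Tree → ℕ → Set
Run P w v t = Program.bodies P ∣ w ∷ [] ⊢ Program.main P ⇓ v ∶ t

-- Evaluation is deterministic, so exhibiting a run of a program
-- determines its output and its running time.
⇓-deterministic : ∀ {n m} {F : Vec (Expr n 1) n} {ρ : Vec Tree m} {e v v′ t t′} →
                  F ∣ ρ ⊢ e ⇓ v ∶ t → F ∣ ρ ⊢ e ⇓ v′ ∶ t′ → v ≡ v′ × t ≡ t′
⇓-deterministic ⇓var ⇓var = refl , refl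
⇓-deterministic ⇓nil ⇓nil = refl , refl
⇓-deterministic (⇓cons a b) (⇓cons a′ b′)
  with refl , refl ← ⇓-deterministic a a′
  with refl , refl ← ⇓-deterministic b b′ = refl , refl
⇓-deterministic (⇓let a b) (⇓let a′ b′)
  with refl , refl ← ⇓-deterministic a a′
  with refl , refl ← ⇓-deterministic b b′ = refl , refl
⇓-deterministic (⇓case-nil a b) (⇓case-nil a′ b′)
  with refl , refl ← ⇓-deterministic a a′
  with refl , refl ← ⇓-deterministic b b′ = refl , refl
⇓-deterministic (⇓case-nil a b) (⇓case-cons a′ b′)
  with () , _ ← ⇓-deterministic a a′
⇓-deterministic (⇓case-cons a b) (⇓case-nil a′ b′)
  with () , _ ← ⇓-deterministic a a′
⇓-deterministic (⇓case-cons a b) (⇓case-cons a′ b′)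
  with refl , refl ← ⇓-deterministic a a′
  with refl , refl ← ⇓-deterministic b b′ = refl , refl
⇓-deterministic (⇓call a b) (⇓call a′ b′)
  with refl , refl ← ⇓-deterministic a a′
  with refl , refl ← ⇓-deterministic b b′ = refl , refl

------------------------------------------------------------------------
-- Encoding of instances
--
-- Numbers (variable names and k) are written in binary, so the size of
-- the encoding is linear in the usual bit length of the instance.

encodeBool : Bool → Tree
encodeBool false = nil
encodeBool true  = cons nil nil

encodeℕᵇ : ℕᵇ → Tree
encodeℕᵇ ℕᵇ.zero  = nil
encodeℕᵇ 2[1+ b ] = cons (encodeBool false) (encodeℕᵇ b)
encodeℕᵇ 1+[2 b ] = cons (encodeBool true) (encodeℕᵇ b)

encodeℕ : ℕ → Tree
encodeℕ n = encodeℕᵇ (ℕᵇ.fromℕ n)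

encodeℤ : ℤ → Tree
encodeℤ (+ n)    = cons (encodeBool true) (encodeℕ n)
encodeℤ -[1+ n ] = cons (encodeBool false) (encodeℕ n)

encodeLiteral : Literal → Tree
encodeLiteral (pos x) = cons (encodeBool true) (encodeℕ x)
encodeLiteral (neg x) = cons (encodeBool false) (encodeℕ x)

encodeList : {A : Set} → (A → Tree) → List A → Tree
encodeList enc []       = nil
encodeList enc (x ∷ xs) = cons (enc x) (encodeList enc xs)

encodeInstance : CNF → ℤ → Tree
encodeInstance Φ k = cons (encodeList (encodeList encodeLiteral) Φ) (encodeℤ k)

{-# OPTIONS --safe #-}
module Submission where

open import Defs
open import Data.Bool.Base using (Bool; true; false; not; _∧_; _∨_)
open import Data.Bool.Properties using (not-involutive)
open import Data.Fin.Base using (Fin; zero; suc; fromℕ<)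
open import Data.Fin using (#_)
open import Data.Fin.Subset as Sub using (Subset; inside; outside)
import Data.Fin.Subset.Properties as Sub
open import Data.Integer.Base as ℤ using (ℤ; -[1+_]; 0ℤ; _⊔_; ∣_∣)
open import Data.List.Base using (List; []; _∷_; _++_; _ʳ++_; length; map)
open import Data.List.Properties using (length-++; length-ʳ++; ++-assoc; ++-identityʳ; length-map)
open import Data.List.Membership.Propositional using (_∈_)
open import Data.List.Membership.Propositional.Properties using (∈-map⁺)
open import Data.List.Relation.Binary.Permutation.Propositional as Perm
  using (_↭_; ↭-sym; ↭-trans; ↭-reflexive; module PermutationReasoning)
open import Data.List.Relation.Binary.Permutation.Propositional.Properties
  using (shift; ↭-length; All-resp-↭; ++-comm; ++⁺ʳ; ++↭ʳ++)
open import Data.List.Relation.Unary.All as All using (All; []; _∷_)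
open import Data.List.Relation.Unary.All.Properties using (++⁺; ++⁻)
open import Data.List.Relation.Unary.Any using (Any; here; there; any?)
open import Data.Nat.Base
  using (ℕ; zero; suc; _+_; _*_; _^_; _≤_; _<_; _⊓_; z≤n; s≤s; s≤s⁻¹)
open import Data.Nat.Binary.Base as ℕᵇ using (ℕᵇ; 2[1+_]; 1+[2_])
import Data.Nat.Binary.Properties as ℕᵇ
open import Data.Nat.Properties hiding (_≟_)
open import Data.Nat.Tactic.RingSolver using (solve-∀)
open import Data.Product.Base using (_×_; _,_; ∃-syntax; proj₁; proj₂)
open import Data.Sum.Base using (_⊎_; inj₁; inj₂)
open import Data.Vec.Base using (Vec; []; _∷_; lookup)
open import Function.Base using (_∘_; case_of_)
open import Relation.Binary.Definitions using (DecidableEquality)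
open import Relation.Binary.PropositionalEquality
  using (_≡_; refl; sym; trans; cong; cong₂; subst; module ≡-Reasoning)
open import Relation.Nullary using (¬_; Dec; yes; no; does; contradiction)
open import Relation.Nullary.Decidable using (map′; _×-dec_; True; toWitness)
open import Relation.Nullary.Reflects using (Reflects; ofʸ; ofⁿ)

-- Every clause a ∨ b contributes the edges ¬a → b and ¬b → a, so that an
-- assignment, seen as the set of its true literals, is left by twice as many
-- edges as it violates clauses.  Hence the budget is 2k edges.  Given a set L of
-- literals set to true, a path from L to the negation of L is reversed as in the
-- Ford–Fulkerson algorithm, which lowers every cut around L, and the budget, by
-- one.  Once there is no path, a literal u that can be added to L without
-- creating one can be added without loss, because the literals reachable from
-- L ∪ {u} form a cut of value 0 (persistency of the half-integral relaxation).
-- If neither u nor its negation can be added, then both branches spend one unit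
-- of the budget, which gives 2 ^ 2k = 4 ^ k leaves.

-- Counting calls

-- The obstacle is that a residual graph is in general not the implication graph of a formula, so
-- the recursion speaks of edge lists and cuts only. Two invariants replace the structure of the
-- formula: a set and its mirror image have cuts of equal value (`Symmetric`), and every endpoint of
-- an edge is already decided or still waiting (`Covered`). A path that is reversed starts inside
-- and ends outside every set that contains `L` and avoids its negations, so it leaves such a set
-- once more often than it enters it. Hence all these cuts, not only the minimum ones, drop by
-- exactly one. An assignment of value `suc r` before has value `r` afterwards, and no flow has to
-- be stored next to the edges and the budget. Since `k` is written in binary, it may be exponential
-- in the input size. The budget is therefore truncated at twice the number of clauses before it is
-- turned into unary.

exprSize : ∀ {n m} → Expr n m → ℕ
exprSize (var x)        = 1
exprSize nil            = 1
exprSize (cons a b)     = suc (exprSize a + exprSize b)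
exprSize (letIn a b)    = suc (exprSize a + exprSize b)
exprSize (caseOf a b c) = suc (exprSize a + (exprSize b + exprSize c))
exprSize (call f a)     = suc (exprSize a)

totalSize : ∀ {n k} → Vec (Expr n 1) k → ℕ
totalSize []      = 0
totalSize (e ∷ F) = exprSize e + totalSize F

exprSize≤totalSize : ∀ {n k} (F : Vec (Expr n 1) k) f → exprSize (lookup F f) ≤ totalSize F
exprSize≤totalSize (e ∷ F) zero    = m≤m+n _ _
exprSize≤totalSize (e ∷ F) (suc f) = ≤-trans (exprSize≤totalSize F f) (m≤n+m _ _)

caseTree : Tree → Set → (Tree → Tree → Set) → Set
caseTree nil        N C = N
caseTree (cons l r) N C = C l r

≤-by : ∀ {m n} d → m + d ≡ n → m ≤ n
≤-by d refl = m≤m+n _ d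

module CallCount {n} (F : Vec (Expr n 1) n) where

  opaque
    K : ℕ
    K = totalSize F

    body≤K : ∀ f → exprSize (lookup F f) ≤ K
    body≤K = exprSize≤totalSize F

  -- No expression evaluates a subexpression twice except through a call, so
  -- c calls cost at most c * K steps, and it suffices to count calls.
  record Computes (f : Fin n) (u v : Tree) (c : ℕ) : Set where
    constructor computes
    field
      {time} : ℕ
      run    : F ∣ u ∷ [] ⊢ lookup F f ⇓ v ∶ time
      bound  : time ≤ c * K

  record AfterCall (f : Fin n) (u : Tree) (Q : Tree → ℕ → Set) : Set where
    constructor _▸_
    field
      {value} : Tree
      {cost}  : ℕ
      callee  : Computes f u value cost
      rest    : Q value cost

  infixr 4 _▸_

  -- Weakest precondition: started with s calls already counted, e yields some
  -- v with m calls counted such that Q v m.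
  wp : ∀ {k} → Expr n k → Vec Tree k → ℕ → (Tree → ℕ → Set) → Set
  wp (var x)        ρ s Q = Q (lookup ρ x) s
  wp nil            ρ s Q = Q nil s
  wp (cons a b)     ρ s Q = wp a ρ s λ v s₁ → wp b ρ s₁ λ w → Q (cons v w)
  wp (letIn a b)    ρ s Q = wp a ρ s λ v s₁ → wp b (v ∷ ρ) s₁ Q
  wp (caseOf a b c) ρ s Q =
    wp a ρ s λ v s₁ → caseTree v (wp b ρ s₁ Q) (λ l r → wp c (l ∷ r ∷ ρ) s₁ Q)
  wp (call f a)     ρ s Q = wp a ρ s λ u s₁ → AfterCall f u λ v c → Q v (c + s₁)

  -- Counted calls act as a potential of `K` steps each: steps inside callees are paid by the growth
  -- of the count from `s` to `m`, all others by the size of `e`. Having `s` on the left avoids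
  -- subtraction and lets the inequality compose along sequencing.
  Outcome : ∀ {k} → Expr n k → Vec Tree k → ℕ → (Tree → ℕ → Set) → Set
  Outcome e ρ s Q =
    ∃[ v ] ∃[ m ] ∃[ t ] F ∣ ρ ⊢ e ⇓ v ∶ t × t + s * K ≤ exprSize e + m * K × Q v m

  join : ∀ {s s₁ s₂} t₁ t₂ {e₁ e₂} → t₁ + s ≤ e₁ + s₁ → t₂ + s₁ ≤ e₂ + s₂ →
         suc (t₁ + t₂) + s ≤ suc (e₁ + e₂) + s₂
  join {s} {s₁} {s₂} t₁ t₂ {e₁} {e₂} p q = s≤s (begin
    t₁ + t₂ + s     ≡⟨ rotate t₁ t₂ s ⟩
    t₂ + (t₁ + s)   ≤⟨ +-monoʳ-≤ t₂ p ⟩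
    t₂ + (e₁ + s₁)  ≡⟨ swapˡ t₂ e₁ s₁ ⟩
    e₁ + (t₂ + s₁)  ≤⟨ +-monoʳ-≤ e₁ q ⟩
    e₁ + (e₂ + s₂)  ≡⟨ +-assoc e₁ e₂ s₂ ⟨
    e₁ + e₂ + s₂    ∎)
    where
    open ≤-Reasoning
    rotate : ∀ a b c → a + b + c ≡ b + (a + c)
    rotate = solve-∀
    swapˡ : ∀ a b c → a + (b + c) ≡ b + (a + c)
    swapˡ = solve-∀

  wp-sound : ∀ {k} (e : Expr n k) ρ s {Q} → wp e ρ s Q → Outcome e ρ s Q
  wp-sound (var x) ρ s q = _ , _ , _ , ⇓var , ≤-refl , q
  wp-sound nil     ρ s q = _ , _ , _ , ⇓nil , ≤-refl , q
  wp-sound (cons a b) ρ s h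
    with _ , s₁ , t₁ , d₁ , p₁ , h₁ ← wp-sound a ρ s h
    with _ , _ , t₂ , d₂ , p₂ , q ← wp-sound b ρ s₁ h₁
    = _ , _ , _ , ⇓cons d₁ d₂ , join t₁ t₂ p₁ p₂ , q
  wp-sound (letIn a b) ρ s h
    with v , s₁ , t₁ , d₁ , p₁ , h₁ ← wp-sound a ρ s h
    with _ , _ , t₂ , d₂ , p₂ , q ← wp-sound b (v ∷ ρ) s₁ h₁
    = _ , _ , _ , ⇓let d₁ d₂ , join t₁ t₂ p₁ p₂ , q
  wp-sound (caseOf a b c) ρ s h
    with wp-sound a ρ s h
  ... | nil , s₁ , t₁ , d₁ , p₁ , h₁
    with _ , _ , t₂ , d₂ , p₂ , q ← wp-sound b ρ s₁ h₁
    = _ , _ , _ , ⇓case-nil d₁ d₂ ,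
      join t₁ t₂ p₁ (≤-trans p₂ (+-monoˡ-≤ _ (m≤m+n (exprSize b) (exprSize c)))) , q
  ... | cons l r , s₁ , t₁ , d₁ , p₁ , h₁
    with _ , _ , t₂ , d₂ , p₂ , q ← wp-sound c (l ∷ r ∷ ρ) s₁ h₁
    = _ , _ , _ , ⇓case-cons d₁ d₂ ,
      join t₁ t₂ p₁ (≤-trans p₂ (+-monoˡ-≤ _ (m≤n+m (exprSize c) (exprSize b)))) , q
  wp-sound (call f a) ρ s h
    with _ , s₁ , t₁ , d₁ , p₁ , h₁ ← wp-sound a ρ s h
    with _▸_ {v} {c} (computes {t₂} d₂ p₂) q ← h₁
    = v , c + s₁ , _ , ⇓call d₁ d₂ , s≤s (begin
        t₁ + t₂ + s * K                      ≡⟨ rotate t₁ t₂ (s * K) ⟩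
        t₂ + (t₁ + s * K)                    ≤⟨ +-mono-≤ p₂ p₁ ⟩
        c * K + (exprSize a + s₁ * K)        ≡⟨ collect c K (exprSize a) s₁ ⟩
        exprSize a + (c + s₁) * K            ∎) , q
    where
    open ≤-Reasoning
    rotate : ∀ a b c → a + b + c ≡ b + (a + c)
    rotate = solve-∀
    collect : ∀ c k e s → c * k + (e + s * k) ≡ e + (c + s) * k
    collect = solve-∀

  -- The count starts at 1 for the call of f itself.
  by-wp : ∀ {f u v c} → wp (lookup F f) (u ∷ []) 1 (λ w m → w ≡ v × m ≤ c) → Computes f u v c
  by-wp {f} {u} {v} {c} h
    with _ , m , t , d , p , refl , m≤c ← wp-sound (lookup F f) (u ∷ []) 1 h
    = computes d (+-cancelʳ-≤ K t (c * K) (begin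
        t + K                            ≡⟨ cong (λ z → t + z) (*-identityˡ K) ⟨
        t + 1 * K                        ≤⟨ p ⟩
        exprSize (lookup F f) + m * K    ≤⟨ +-mono-≤ (body≤K f) (*-monoˡ-≤ K m≤c) ⟩
        K + c * K                        ≡⟨ +-comm K (c * K) ⟩
        c * K + K                        ∎))
    where open ≤-Reasoning

  weaken : ∀ {f u v c d} → c ≤ d → Computes f u v c → Computes f u v d
  weaken c≤d (computes r p) = computes r (≤-trans p (*-monoˡ-≤ K c≤d))

-- The program

infix 9 ‵_

‵_ : ∀ {n m} k {k<m : True (k <? m)} → Expr n m
‵_ k {k<m} = var (fromℕ< (toWitness k<m))

-- Pattern matching on an argument that is never nil.
split : ∀ {n m} → Expr n m → Expr n (2 + m) → Expr n m
split e e′ = caseOf e nil e′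

true′ : ∀ {n m} → Expr n m
true′ = cons nil nil

eqF negF memF findF revF backF scanF solveF edgesF headsF doubleF budgetF : Fin 12
eqF     = # 0
negF    = # 1
memF    = # 2
findF   = # 3
revF    = # 4
backF   = # 5
scanF   = # 6
solveF  = # 7
edgesF  = # 8
headsF  = # 9
doubleF = # 10
budgetF = # 11

eqB negB memB findB revB backB scanB solveB edgesB headsB doubleB budgetB : Expr 12 1

-- The comments below name the components of the argument, here x and y.
eqB = split (‵ 0) (caseOf (‵ 0)
  (caseOf (‵ 1) true′ nil)
  (split (‵ 3) (caseOf (call eqF (cons (‵ 2) (‵ 0))) nil (call eqF (cons (‵ 5) (‵ 3))))))

negB = split (‵ 0) (caseOf (‵ 0) (cons true′ (‵ 1)) (cons nil (‵ 3)))

-- x, L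
memB = split (‵ 0) (caseOf (‵ 1) nil
  (caseOf (call eqF (cons (‵ 2) (‵ 0))) (call memF (cons (‵ 2) (‵ 1))) true′))

-- L, R: some negation of an element of L that lies in R
findB = split (‵ 0) (caseOf (‵ 0) nil
  (letIn (call negF (‵ 0))
    (caseOf (call memF (cons (‵ 0) (‵ 4))) (call findF (cons (‵ 2) (‵ 4))) (cons (‵ 2) nil))))

-- G, H: the reverse of G followed by H
revB = split (‵ 0) (caseOf (‵ 0) (‵ 1) (call revF (cons (‵ 1) (cons (‵ 0) (‵ 3)))))

-- c, T, G: adds the edges of T to G, those on the path of T that ends in c reversed
backB = split (‵ 0) (split (‵ 1) (caseOf (‵ 0) (‵ 1) (split (‵ 0)
  (caseOf (call eqF (cons (‵ 6) (‵ 1)))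
    (call backF (cons (‵ 6) (cons (‵ 3) (cons (‵ 2) (‵ 5)))))
    (call backF (cons (‵ 2) (cons (‵ 5) (cons (cons (‵ 3) (‵ 2)) (‵ 7)))))))))

-- G, H, R, T, L: edges to inspect, edges inspected, nodes reached from L, edges
-- used to reach them (latest first)
scanB = split (‵ 0) (split (‵ 1) (split (‵ 1) (split (‵ 1) (caseOf (‵ 6)
  (split (call findF (cons (‵ 1) (‵ 2)))
    (cons nil (call backF (cons (‵ 0) (cons (‵ 2) (‵ 6))))))
  (split (‵ 0) (caseOf (call memF (cons (‵ 0) (‵ 6)))
    (call scanF (cons (‵ 3) (cons (cons (‵ 2) (‵ 8)) (cons (‵ 6) (cons (‵ 4) (‵ 5))))))
    (caseOf (call memF (cons (‵ 3) (‵ 8)))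
      (call scanF (cons (call revF (cons (‵ 10) (‵ 5)))
        (cons nil (cons (cons (‵ 3) (‵ 8)) (cons (cons (‵ 4) (‵ 6)) (‵ 7))))))
      (call scanF (cons (‵ 7) (cons (cons (‵ 6) (‵ 12)) (cons (‵ 10) (cons (‵ 8) (‵ 9)))))))))))))

-- either nil, or cons nil G′ where G′ is G with a path from L to its negation reversed
augment : ∀ {m} → Expr 12 m → Expr 12 m → Expr 12 m
augment G L = call scanF (cons G (cons nil (cons L (cons nil L))))

-- U, r, G, L: nodes to decide, budget, residual graph, nodes set to true
solveB = split (‵ 0) (split (‵ 1) (split (‵ 1) (caseOf (augment (‵ 0) (‵ 1))
  (caseOf (‵ 4) true′
    (caseOf (augment (‵ 2) (cons (‵ 0) (‵ 3)))
      (call solveF (cons (‵ 1) (cons (‵ 4) (cons (‵ 2) (cons (‵ 0) (‵ 3))))))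
      (letIn (call negF (‵ 2))
        (caseOf (augment (‵ 5) (cons (‵ 0) (‵ 6)))
          (call solveF (cons (‵ 4) (cons (‵ 7) (cons (‵ 5) (cons (‵ 0) (‵ 6))))))
          (split (‵ 9)
            (caseOf (call solveF (cons (‵ 8) (cons (‵ 1) (cons (‵ 6) (cons (‵ 7) (‵ 10))))))
              (call solveF (cons (‵ 8) (cons (‵ 1) (cons (‵ 3) (cons (‵ 4) (‵ 10))))))
              true′))))))
  (split (‵ 4) (call solveF (cons (‵ 8) (cons (‵ 1) (cons (‵ 3) (‵ 5)))))))))

-- Differs from the encoding of every number, since its head encodes no Bool.
⊤name : Tree
⊤name = cons (cons (cons nil nil) nil) nil

⊤name′ ⊤′ ⊥′ : ∀ {m} → Expr 12 m
⊤name′ = cons (cons (cons nil nil) nil) nil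
⊤′ = cons true′ ⊤name′
⊥′ = cons nil ⊤name′

edgesB = caseOf (‵ 0) nil (letIn
  (caseOf (‵ 0) (cons ⊥′ ⊥′) (caseOf (‵ 1) (cons (‵ 0) ⊥′) (cons (‵ 2) (‵ 0))))
  (split (‵ 0) (cons (cons (call negF (‵ 0)) (‵ 1))
    (cons (cons (call negF (‵ 1)) (‵ 0)) (call edgesF (‵ 4))))))

headsB = caseOf (‵ 0) nil (split (‵ 0) (cons (‵ 1) (call headsF (‵ 3))))

-- The digits of bijective binary are 1 and 2, so doubling has to propagate: twice `1+[2 b ]` is
-- `2[1+_]` of the double of `b`. It serves the countdown in `budgetB`, because the double of `b` is
-- the predecessor of `1+[2 b ]`.
doubleB = caseOf (‵ 0) nil
  (caseOf (‵ 0) (cons nil (cons true′ (‵ 1))) (cons nil (call doubleF (‵ 3))))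

-- k, Φ: twice the minimum of k and the number of clauses, in unary
budgetB = split (‵ 0) (caseOf (‵ 0) nil (caseOf (‵ 3) nil
  (letIn (caseOf (‵ 2) (cons true′ (‵ 3)) (call doubleF (‵ 5)))
    (cons nil (cons nil (call budgetF (cons (‵ 0) (‵ 2))))))))

bodies : Vec (Expr 12 1) 12
bodies = eqB ∷ negB ∷ memB ∷ findB ∷ revB ∷ backB ∷ scanB ∷ solveB
       ∷ edgesB ∷ headsB ∷ doubleB ∷ budgetB ∷ []

mainB : Expr 12 1
mainB = split (‵ 0) (split (‵ 1) (caseOf (‵ 0) nil (letIn (call edgesF (‵ 4))
  (call solveF (cons (call headsF (‵ 0)) (cons (call budgetF (cons (‵ 4) (‵ 5)))
    (cons (‵ 0) (cons ⊤′ nil))))))))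

open CallCount bodies

-- Nodes of the implication graph

-- The literal named by name, positive if sign is true; ⊤name names the
-- constant true.  B bounds the cost of one comparison.
record Node (B : ℕ) : Set where
  constructor node
  field
    sign  : Bool
    name  : Tree
    small : 4 + size name ≤ B

open Node

Edge : ℕ → Set
Edge B = Node B × Node B

variable
  B : ℕ

infix 8 ~_

~_ : Node B → Node B
~ node s n p = node (not s) n p

~-involutive : (x : Node B) → ~ ~ x ≡ x
~-involutive (node s n p) = cong (λ b → node b n p) (not-involutive s)

encodeNode : Node B → Tree
encodeNode x = cons (encodeBool (sign x)) (name x)

encodeEdge : Edge B → Tree
encodeEdge (x , y) = cons (encodeNode x) (encodeNode y)

encodeNodes : List (Node B) → Tree
encodeNodes = encodeList encodeNode

encodeEdges : List (Edge B) → Tree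
encodeEdges = encodeList encodeEdge

encodeUnary : ℕ → Tree
encodeUnary zero    = nil
encodeUnary (suc n) = cons nil (encodeUnary n)

encodeNode-injective : {x y : Node B} → encodeNode x ≡ encodeNode y → x ≡ y
encodeNode-injective {x = node true n p}  {node true .n q}  refl = cong (node true n) (≤-irrelevant p q)
encodeNode-injective {x = node false n p} {node false .n q} refl = cong (node false n) (≤-irrelevant p q)

size-encodeNode : (x : Node B) → size (encodeNode x) ≤ B
size-encodeNode (node true n p)  = p
size-encodeNode (node false n p) = ≤-trans (+-monoˡ-≤ (size n) (s≤s (s≤s z≤n))) p

infix 4 _≟ᵗ_ _≟_ _∈?_

_≟ᵗ_ : DecidableEquality Tree
nil      ≟ᵗ nil        = yes refl
nil      ≟ᵗ cons _ _   = no λ ()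
cons _ _ ≟ᵗ nil        = no λ ()
cons l r ≟ᵗ cons l′ r′ =
  map′ (λ (p , q) → cong₂ cons p q) (λ { refl → refl , refl }) (l ≟ᵗ l′ ×-dec r ≟ᵗ r′)

-- Opaque, so that the decisions below can be abstracted by with.
opaque
  _≟_ : DecidableEquality (Node B)
  x ≟ y = map′ encodeNode-injective (cong encodeNode) (encodeNode x ≟ᵗ encodeNode y)

opaque
  _∈?_ : (x : Node B) (L : List (Node B)) → Dec (x ∈ L)
  x ∈? L = any? (x ≟_) L

-- Each call consumes its own node of the first tree, so the size of that tree alone bounds the
-- calls.
eq-computes : ∀ x y → Computes eqF (cons x y) (encodeBool (does (x ≟ᵗ y))) (size x)
eq-computes nil        nil        = by-wp (refl , ≤-refl)
eq-computes nil        (cons _ _) = by-wp (refl , ≤-refl)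
eq-computes (cons l r) nil        = by-wp (refl , s≤s z≤n)
eq-computes (cons l r) (cons l′ r′) with l ≟ᵗ l′ | eq-computes l l′
... | no _  | h = by-wp (h ▸ refl , ≤-trans (≤-reflexive (+-comm (size l) 1)) (s≤s (m≤m+n _ _)))
... | yes _ | h = by-wp (h ▸ eq-computes r r′ ▸ refl , ≤-reflexive (arith (size l) (size r)))
  where
  arith : ∀ a b → b + (a + 1) ≡ suc (a + b)
  arith = solve-∀

opaque
  unfolding _≟_
  ≟-computes : (x y : Node B) →
               Computes eqF (cons (encodeNode x) (encodeNode y)) (encodeBool (does (x ≟ y))) B
  ≟-computes x y = weaken (size-encodeNode x) (eq-computes (encodeNode x) (encodeNode y))

neg-computes : (x : Node B) → Computes negF (encodeNode x) (encodeNode (~ x)) 1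
neg-computes (node true  _ _) = by-wp (refl , ≤-refl)
neg-computes (node false _ _) = by-wp (refl , ≤-refl)

memCost : ℕ → ℕ → ℕ
memCost B l = 1 + l * (1 + B)

opaque
  unfolding _∈?_
  mem-computes : (x : Node B) (L : List (Node B)) →
                 Computes memF (cons (encodeNode x) (encodeNodes L)) (encodeBool (does (x ∈? L)))
                          (memCost B (length L))
  mem-computes x [] = by-wp (refl , ≤-refl)
  mem-computes {B} x (y ∷ L) with x ≟ y | ≟-computes x y
  ... | yes _ | h = by-wp (h ▸ refl , ≤-by _ (arith B (length L)))
    where
    arith : ∀ b l → b + 1 + (1 + l * (1 + b)) ≡ 1 + suc l * (1 + b)
    arith = solve-∀
  ... | no _ | h = by-wp (h ▸ mem-computes x L ▸ refl , ≤-reflexive (arith B (length L)))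
    where
    arith : ∀ b l → 1 + l * (1 + b) + (b + 1) ≡ 1 + suc l * (1 + b)
    arith = solve-∀

rev-computes : (G H : List (Edge B)) →
               Computes revF (cons (encodeEdges G) (encodeEdges H)) (encodeEdges (G ʳ++ H)) (1 + length G)
rev-computes [] H = by-wp (refl , ≤-refl)
rev-computes (e ∷ G) H = by-wp (rev-computes G (e ∷ H) ▸ refl , ≤-reflexive (+-comm _ 1))

findCost : ℕ → ℕ → ℕ → ℕ
findCost B l r = 1 + l * (2 + memCost B r)

data Found {B} (L R : List (Node B)) : Tree → Set where
  consistent   : (∀ {x} → x ∈ L → ¬ ~ x ∈ R) → Found L R nil
  inconsistent : ∀ {x} → x ∈ L → ~ x ∈ R → Found L R (cons (encodeNode (~ x)) nil)

find-computes : (L R : List (Node B)) →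
                ∃[ v ] Computes findF (cons (encodeNodes L) (encodeNodes R)) v
                                (findCost B (length L) (length R))
                       × Found L R v
find-computes [] R = _ , by-wp (refl , ≤-refl) , consistent λ ()
find-computes {B} (x ∷ L) R with ~ x ∈? R | mem-computes (~ x) R
... | yes p | h = _ , by-wp (neg-computes x ▸ h ▸ refl , ≤-by _ (arith (memCost B (length R)) (length L))) ,
                  inconsistent (here refl) p
  where
  arith : ∀ m l → m + 2 + (1 + l * (2 + m)) ≡ 1 + suc l * (2 + m)
  arith = solve-∀
... | no p | h with find-computes L R
...   | v , hv , f = _ , by-wp (neg-computes x ▸ h ▸ hv ▸ refl ,
                                ≤-reflexive (arith (memCost B (length R)) (length L))) , extend f
  where
  arith : ∀ m l → 1 + l * (2 + m) + (m + 2) ≡ 1 + suc l * (2 + m)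
  arith = solve-∀
  extend : ∀ {v} → Found L R v → Found (x ∷ L) R v
  extend (consistent c) = consistent λ { (here refl) → p ; (there q) → c q }
  extend (inconsistent q r) = inconsistent (there q) r

-- Cuts and augmenting paths

NodeSet : ℕ → Set
NodeSet B = Node B → Bool

𝟙 : Bool → ℕ
𝟙 true  = 1
𝟙 false = 0

leaving : Bool → Bool → ℕ
leaving true  false = 1
leaving true  true  = 0
leaving false _     = 0

δ : List (Edge B) → NodeSet B → ℕ
δ []            S = 0
δ ((x , y) ∷ G) S = leaving (S x) (S y) + δ G S

δ-++ : (G H : List (Edge B)) (S : NodeSet B) → δ (G ++ H) S ≡ δ G S + δ H S
δ-++ []            H S = refl
δ-++ ((x , y) ∷ G) H S = trans (cong (λ z → leaving (S x) (S y) + z) (δ-++ G H S))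
                               (sym (+-assoc (leaving (S x) (S y)) _ _))

δ-↭ : {G H : List (Edge B)} → G ↭ H → (S : NodeSet B) → δ G S ≡ δ H S
δ-↭ Perm.refl              S = refl
δ-↭ (Perm.prep (x , y) p)       S = cong (λ z → leaving (S x) (S y) + z) (δ-↭ p S)
δ-↭ {H = _ ∷ _ ∷ ys} (Perm.swap (x , y) (z , w) p) S =
  trans (cong (λ n → leaving (S x) (S y) + (leaving (S z) (S w) + n)) (δ-↭ p S))
        (exchange (leaving (S x) (S y)) (leaving (S z) (S w)) (δ ys S))
  where
  exchange : ∀ a b c → a + (b + c) ≡ b + (a + c)
  exchange = solve-∀
δ-↭ (Perm.trans p q)            S = trans (δ-↭ p S) (δ-↭ q S)

Separates : NodeSet B → List (Node B) → Set
Separates S L = ∀ {x} → x ∈ L → S x ≡ true × S (~ x) ≡ false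

-- `G′` consists of the edges of `G`, some of them reversed, which is what `preserves` expresses. If
-- `L` contains a node and its negation, nothing separates `L` and `cut-decreases` is vacuous; a
-- node whose negation is already set to true thus counts as one that cannot be added.
record Augmented {B} (L : List (Node B)) (G G′ : List (Edge B)) : Set₁ where
  field
    cut-decreases : ∀ S → Separates S L → suc (δ G′ S) ≡ δ G S
    same-length   : length G′ ≡ length G
    preserves     : ∀ {P : Edge B → Set} → (∀ {x y} → P (x , y) → P (y , x)) → All P G → All P G′

open Augmented

data ScanResult {B} (L : List (Node B)) (G : List (Edge B)) : Tree → Set₁ where
  closed    : (R : NodeSet B) → Separates R L → δ G R ≡ 0 → ScanResult L G nil
  augmented : ∀ {G′} → Augmented L G G′ → ScanResult L G (cons nil (encodeEdges G′))

-- Search forests and the reversal of a path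

reached : List (Node B) → List (Edge B) → List (Node B)
reached L []            = L
reached L ((x , y) ∷ T) = y ∷ reached L T

-- A search forest rooted in L, the latest edge first.
data Forest {B} (L : List (Node B)) : List (Edge B) → Set where
  []  : Forest L []
  _∷_ : ∀ {x y T} → x ∈ reached L T → Forest L T → Forest L ((x , y) ∷ T)

length-reached : (L : List (Node B)) (T : List (Edge B)) → length (reached L T) ≡ length L + length T
length-reached L []      = sym (+-identityʳ _)
length-reached L (_ ∷ T) = trans (cong suc (length-reached L T)) (sym (+-suc _ _))

⊆-reached : (L : List (Node B)) (T : List (Edge B)) {x : Node B} → x ∈ L → x ∈ reached L T
⊆-reached L []      p = p
⊆-reached L (_ ∷ T) p = there (⊆-reached L T p)

Closed : List (Node B) → Edge B → Set
Closed R (x , y) = x ∈ R → y ∈ R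

heads-reached : (L : List (Node B)) (T : List (Edge B)) → All (λ e → proj₂ e ∈ reached L T) T
heads-reached L []      = []
heads-reached L (_ ∷ T) = here refl ∷ All.map there (heads-reached L T)

χ : List (Node B) → NodeSet B
χ R x = does (x ∈? R)

χ⁺ : {R : List (Node B)} {x : Node B} → x ∈ R → χ R x ≡ true
χ⁺ {R = R} {x} p with x ∈? R
... | yes _ = refl
... | no ¬p = contradiction p ¬p

χ⁻ : {R : List (Node B)} {x : Node B} → ¬ x ∈ R → χ R x ≡ false
χ⁻ {R = R} {x} ¬p with x ∈? R
... | yes p = contradiction p ¬p
... | no _  = refl

δ-closed : {R : List (Node B)} {G : List (Edge B)} → All (Closed R) G → δ G (χ R) ≡ 0
δ-closed [] = refl
δ-closed {R = R} {(x , y) ∷ G} (c ∷ cs) with x ∈? R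
... | no _ = δ-closed cs
... | yes p rewrite χ⁺ (c p) = δ-closed cs

backCost : ℕ → ℕ → ℕ
backCost B t = 1 + t * (1 + B)

-- Reversing an edge changes its contribution by a difference of endpoint indicators, so the changes
-- telescope along a path.
leaving-reverse : ∀ a b → leaving b a + 𝟙 a ≡ leaving a b + 𝟙 b
leaving-reverse true  true  = refl
leaving-reverse true  false = refl
leaving-reverse false true  = refl
leaving-reverse false false = refl

-- A path from `L` to `c` leaves a set `S` containing `L` on balance `1` minus `𝟙 (S c)` times, and
-- its reversal lowers the cut by that amount. Leaving the endpoint `c` general is what makes an
-- induction along the path possible.
record Rerouted {B} (L : List (Node B)) (c : Node B) (T G G′ : List (Edge B)) : Set₁ where
  field
    cut-shift   : ∀ S → (∀ {x} → x ∈ L → S x ≡ true) → suc (δ G′ S) ≡ 𝟙 (S c) + (δ T S + δ G S)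
    same-length : length G′ ≡ length T + length G
    preserves   : ∀ {P : Edge B → Set} → (∀ {x y} → P (x , y) → P (y , x)) →
                  All P T → All P G → All P G′

-- The tail of a forest edge was reached by an edge added earlier, hence listed later, or lies in
-- `L`. So a single pass over `T` meets the edges of the path in the order from `c` back to `L`.
back-computes : (L : List (Node B)) (T G : List (Edge B)) (c : Node B) →
                Forest L T → c ∈ reached L T →
                ∃[ G′ ] Computes backF (cons (encodeNode c) (cons (encodeEdges T) (encodeEdges G)))
                                 (encodeEdges G′) (backCost B (length T))
                        × Rerouted L c T G G′
back-computes L [] G c [] c∈L = G , by-wp (refl , ≤-refl) , record
  { cut-shift   = λ S h → cong (λ b → 𝟙 b + δ G S) (sym (h c∈L))
  ; same-length = refl
  ; preserves   = λ _ _ q → q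
  }
back-computes {B} L ((x , y) ∷ T) G c (x∈ ∷ F) c∈ with c ≟ y | ≟-computes c y
... | yes refl | h =
  let G′ , hb , r = back-computes L T ((y , x) ∷ G) x F x∈ in
  G′ , by-wp (h ▸ hb ▸ refl , ≤-reflexive (arith B (length T))) , record
  { cut-shift   = λ S hS → trans (Rerouted.cut-shift r S hS) (begin
      𝟙 (S x) + (δ T S + (leaving (S y) (S x) + δ G S))
        ≡⟨ collect (𝟙 (S x)) (leaving (S y) (S x)) (δ T S) (δ G S) ⟩
      leaving (S y) (S x) + 𝟙 (S x) + (δ T S + δ G S)
        ≡⟨ cong (λ z → z + (δ T S + δ G S)) (leaving-reverse (S x) (S y)) ⟩
      leaving (S x) (S y) + 𝟙 (S y) + (δ T S + δ G S)
        ≡⟨ spread (𝟙 (S y)) (leaving (S x) (S y)) (δ T S) (δ G S) ⟩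
      𝟙 (S y) + (leaving (S x) (S y) + δ T S + δ G S) ∎)
  ; same-length = trans (Rerouted.same-length r) (+-suc (length T) (length G))
  ; preserves   = λ { s (p ∷ ps) q → Rerouted.preserves r s ps (s p ∷ q) }
  }
  where
  open ≡-Reasoning
  collect : ∀ a b t g → a + (t + (b + g)) ≡ b + a + (t + g)
  collect = solve-∀
  spread : ∀ a b t g → b + a + (t + g) ≡ a + (b + t + g)
  spread = solve-∀
  arith : ∀ b t → 1 + t * (1 + b) + (b + 1) ≡ 1 + suc t * (1 + b)
  arith = solve-∀
back-computes {B} L ((x , y) ∷ T) G c (x∈ ∷ F) (here c≡y) | no c≢y | h = contradiction c≡y c≢y
back-computes {B} L ((x , y) ∷ T) G c (x∈ ∷ F) (there c∈) | no c≢y | h =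
  let G′ , hb , r = back-computes L T ((x , y) ∷ G) c F c∈ in
  G′ , by-wp (h ▸ hb ▸ refl , ≤-reflexive (arith B (length T))) , record
  { cut-shift   = λ S hS → trans (Rerouted.cut-shift r S hS)
                    (cong (λ z → 𝟙 (S c) + z) (move (leaving (S x) (S y)) (δ T S) (δ G S)))
  ; same-length = trans (Rerouted.same-length r) (+-suc (length T) (length G))
  ; preserves   = λ { s (p ∷ ps) q → Rerouted.preserves r s ps (p ∷ q) }
  }
  where
  move : ∀ b t g → t + (b + g) ≡ b + t + g
  move = solve-∀
  arith : ∀ b t → 1 + t * (1 + b) + (b + 1) ≡ 1 + suc t * (1 + b)
  arith = solve-∀

memCost-mono : ∀ {l M} → l ≤ M → memCost B l ≤ memCost B M
memCost-mono {B} p = s≤s (*-monoˡ-≤ (1 + B) p)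

findCost-mono : ∀ {l r M} → l ≤ M → r ≤ M → findCost B l r ≤ findCost B M M
findCost-mono p q = s≤s (*-mono-≤ p (s≤s (s≤s (memCost-mono q))))

-- Cost and correctness of the search

one-more : ∀ {a m n} u → a ≤ u → m < n → m * u + a ≤ n * u
one-more {a} {m} {n} u p q = begin
  m * u + a  ≤⟨ +-monoʳ-≤ (m * u) p ⟩
  m * u + u  ≡⟨ +-comm (m * u) u ⟩
  suc m * u  ≤⟨ *-monoˡ-≤ u q ⟩
  n * u      ∎
  where open ≤-Reasoning

opaque
  -- The cost of a call of scan on lists of length at most M, its recursive call excepted.
  scanUnit : ℕ → ℕ → ℕ
  scanUnit B M =
    (1 + M) + (memCost B M + (memCost B M + 1)) + (backCost B M + (findCost B M M + 1))

  -- Each of the q edges left can restart the scan of at most M edges.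
  scanCost : ℕ → ℕ → ℕ → ℕ → ℕ
  scanCost B M q g = (1 + g + q * suc M) * scanUnit B M

  find≤scanUnit : ∀ {M l r} → l ≤ M → r ≤ M → findCost B l r + 1 ≤ scanUnit B M
  find≤scanUnit {B} {M} l≤M r≤M = ≤-trans (+-monoˡ-≤ 1 (findCost-mono l≤M r≤M))
    (≤-trans (m≤n+m _ (backCost B M))
             (m≤n+m _ ((1 + M) + (memCost B M + (memCost B M + 1)))))

  back≤scanUnit : ∀ {M l r t} → l ≤ M → r ≤ M → t ≤ M →
                  backCost B t + (findCost B l r + 1) ≤ scanUnit B M
  back≤scanUnit {B} {M} {l} {r} {t} l≤M r≤M t≤M = ≤-trans
    (+-mono-≤ {backCost B t} (s≤s (*-monoˡ-≤ (1 + B) t≤M)) (+-monoˡ-≤ 1 (findCost-mono {l = l} l≤M r≤M)))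
    (m≤n+m _ ((1 + M) + (memCost B M + (memCost B M + 1))))

  mems≤scanUnit : ∀ {M r h} → r ≤ M → h ≤ M →
                  1 + h + (memCost B r + (memCost B r + 1)) ≤ scanUnit B M
  mems≤scanUnit r≤M h≤M = ≤-trans
    (+-mono-≤ (s≤s h≤M) (+-mono-≤ (memCost-mono r≤M) (+-monoˡ-≤ 1 (memCost-mono r≤M))))
    (m≤m+n _ _)

  scan-end : ∀ {M q a} → a ≤ scanUnit B M → a ≤ scanCost B M q 0
  scan-end {B} {M} {q} p = one-more {m = 0} {n = 1 + q * suc M} (scanUnit B M) p (s≤s z≤n)

  scan-next : ∀ {M q g a} → a ≤ scanUnit B M → scanCost B M q g + a ≤ scanCost B M q (suc g)
  scan-next {B} {M} {q} {g} p =
    one-more {m = 1 + g + q * suc M} {n = 2 + g + q * suc M} (scanUnit B M) p ≤-refl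

  -- The edge that joins the forest releases `suc M` units, which pay for inspecting the at most `M`
  -- remaining edges again.
  scan-restart : ∀ {M q g a} → q ≤ M → a ≤ scanUnit B M →
                 scanCost B M q q + a ≤ scanCost B M (suc q) (suc g)
  scan-restart {B} {M} {q} {g} q≤M p =
    one-more {m = 1 + q + q * suc M} {n = 2 + g + suc q * suc M} (scanUnit B M) p (begin-strict
      suc q + q * suc M      ≤⟨ +-monoˡ-≤ (q * suc M) (s≤s q≤M) ⟩
      suc q * suc M          <⟨ n<1+n _ ⟩
      1 + suc q * suc M      ≤⟨ +-monoˡ-≤ (suc q * suc M) {1} {2 + g} (s≤s z≤n) ⟩
      2 + g + suc q * suc M  ∎)
    where open ≤-Reasoning

  scanCost-mono : ∀ {M q g} → q ≤ M → g ≤ M → scanCost B M q g ≤ scanCost B M M M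
  scanCost-mono {B} {M} q≤M g≤M =
    *-monoˡ-≤ (scanUnit B M) (+-mono-≤ (s≤s g≤M) (*-monoˡ-≤ (suc M) q≤M))

-- The edges to inspect, the edges inspected and the forest make up the original graph up to order,
-- so a bound on `L` and that graph bounds every list of the search.
module ScanLengths {B M q} (L : List (Node B)) (T H G : List (Edge B)) {G₀}
  (lq : length G + length H ≡ q) (p : G₀ ↭ G ++ (H ++ T)) (lM : length L + length G₀ ≤ M) where

  total : q + length T ≡ length G₀
  total = begin
    q + length T                        ≡⟨ cong (_+ length T) lq ⟨
    length G + length H + length T      ≡⟨ +-assoc (length G) _ _ ⟩
    length G + (length H + length T)    ≡⟨ cong (length G +_) (length-++ H) ⟨
    length G + length (H ++ T)          ≡⟨ length-++ G ⟨
    length (G ++ H ++ T)                ≡⟨ ↭-length p ⟨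
    length G₀                           ∎
    where open ≡-Reasoning

  G₀≤M : length G₀ ≤ M
  G₀≤M = ≤-trans (m≤n+m _ (length L)) lM

  L≤M : length L ≤ M
  L≤M = ≤-trans (m≤m+n _ _) lM

  T≤G₀ : length T ≤ length G₀
  T≤G₀ = ≤-trans (m≤n+m _ q) (≤-reflexive total)

  T≤M : length T ≤ M
  T≤M = ≤-trans T≤G₀ G₀≤M

  q≤M : q ≤ M
  q≤M = ≤-trans (≤-trans (m≤m+n q _) (≤-reflexive total)) G₀≤M

  H≤M : length H ≤ M
  H≤M = ≤-trans (≤-trans (m≤n+m _ (length G)) (≤-reflexive lq)) q≤M

  R≤M : length (reached L T) ≤ M
  R≤M = ≤-trans (≤-reflexive (length-reached L T)) (≤-trans (+-monoʳ-≤ (length L) T≤G₀) lM)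

  two-mem+rev : 1 + length H + (memCost B (length (reached L T)) + (memCost B (length (reached L T)) + 1))
                ≤ scanUnit B M
  two-mem+rev = mems≤scanUnit R≤M H≤M

  two-mem : memCost B (length (reached L T)) + (memCost B (length (reached L T)) + 1) ≤ scanUnit B M
  two-mem = ≤-trans (m≤n+m _ (1 + length H)) two-mem+rev

  one-mem : memCost B (length (reached L T)) + 1 ≤ scanUnit B M
  one-mem = ≤-trans (m≤n+m _ (memCost B (length (reached L T)))) two-mem

length-restart : ∀ {q} (G H : List (Edge B)) → length G + length H ≡ q → length (H ʳ++ G) ≡ q
length-restart G H lq = trans (length-ʳ++ H) (trans (+-comm (length H) _) lq)

↭-restart : ∀ {e} {G₀} (G H T : List (Edge B)) →
            G₀ ↭ e ∷ G ++ (H ++ T) → G₀ ↭ (H ʳ++ G) ++ (e ∷ T)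
↭-restart {e = e} {G₀} G H T p = begin
  G₀                       ↭⟨ p ⟩
  e ∷ G ++ H ++ T          ≡⟨ cong (e ∷_) (++-assoc G H T) ⟨
  e ∷ (G ++ H) ++ T        ↭⟨ shift e (G ++ H) T ⟨
  (G ++ H) ++ e ∷ T        ↭⟨ ++⁺ʳ (e ∷ T) (++-comm G H) ⟩
  (H ++ G) ++ e ∷ T        ↭⟨ ++⁺ʳ (e ∷ T) (++↭ʳ++ H G) ⟩
  (H ʳ++ G) ++ e ∷ T       ∎
  where open PermutationReasoning

ScanFrom : ℕ → ℕ → (G H T : List (Edge B)) → List (Node B) → List (Edge B) → Set₁
ScanFrom {B} M q G H T L G₀ = ∃[ v ]
  Computes scanF
    (cons (encodeEdges G) (cons (encodeEdges H)
      (cons (encodeNodes (reached L T)) (cons (encodeEdges T) (encodeNodes L)))))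
    v (scanCost B M q (length G))
  × ScanResult L G₀ v

-- The reached set is closed under `H` by `cl`, and under `T` because heads of forest edges are
-- reached, so it is a cut of value 0. If it contains `~ x` for some `x` in `L`, the forest path to
-- `~ x` is reversed; a separating `S` omits `~ x`, which turns `cut-shift` into a decrease by one.
scan-last : ∀ {M q} (H T : List (Edge B)) (L : List (Node B)) {G₀} →
            length H ≡ q → length L + length G₀ ≤ M →
            Forest L T → G₀ ↭ H ++ T → All (Closed (reached L T)) H →
            ScanFrom M q [] H T L G₀
scan-last {B} {M} {q} H T L {G₀} lq lM F p cl
  with find-computes L (reached L T)
... | _ , h , consistent c =
  _ , by-wp (h ▸ refl , scan-end (find≤scanUnit {l = length L} L≤M R≤M)) ,
  closed (χ R) (λ x∈L → χ⁺ (⊆-reached L T x∈L) , χ⁻ (c x∈L))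
    (δ-closed (All-resp-↭ (↭-sym p) (++⁺ cl (All.map (λ y∈R _ → y∈R) (heads-reached L T)))))
  where
  open ScanLengths L T H [] lq p lM
  R = reached L T
... | _ , h , inconsistent {x} x∈L x∈R
  with G′ , hb , r ← back-computes L T H (~ x) F x∈R
  = _ , by-wp (h ▸ hb ▸ refl , scan-end (back≤scanUnit {l = length L} {t = length T} L≤M R≤M T≤M)) , augmented record
  { cut-decreases = λ S sep → trans (Rerouted.cut-shift r S (proj₁ ∘ sep))
      (trans (cong (λ b → 𝟙 b + (δ T S + δ H S)) (proj₂ (sep x∈L)))
             (trans (+-comm (δ T S) (δ H S)) (trans (sym (δ-++ H T S)) (sym (δ-↭ p S)))))
  ; same-length   = trans (Rerouted.same-length r)
      (trans (+-comm (length T) (length H)) (trans (sym (length-++ H)) (sym (↭-length p))))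
  ; preserves     = λ s a → let b , c = ++⁻ H (All-resp-↭ p a) in Rerouted.preserves r s c b
  }
  where open ScanLengths L T H [] lq p lM

-- The arguments `skip` and `add` are the induction hypotheses for the two ways to go on: the edge
-- is closed under the reached set, or its head is new.
scan-edge : ∀ {M q x y} (G H T : List (Edge B)) (L : List (Node B)) {G₀} →
            length ((x , y) ∷ G) + length H ≡ suc q → length L + length G₀ ≤ M →
            G₀ ↭ (x , y) ∷ G ++ (H ++ T) →
            (Closed (reached L T) (x , y) → ScanFrom M (suc q) G ((x , y) ∷ H) T L G₀) →
            (x ∈ reached L T → ScanFrom M q (H ʳ++ G) [] ((x , y) ∷ T) L G₀) →
            ScanFrom M (suc q) ((x , y) ∷ G) H T L G₀
scan-edge {B} {M} {q} {x} {y} G H T L lq lM p skip add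
  with x ∈? reached L T | mem-computes x (reached L T) | y ∈? reached L T | mem-computes y (reached L T)
... | no x∉R | h₁ | _ | _
  with v , hs , res ← skip (λ x∈R → contradiction x∈R x∉R)
  = v , by-wp (h₁ ▸ hs ▸ refl , scan-next one-mem) , res
  where open ScanLengths L T H ((x , y) ∷ G) lq p lM
... | yes x∈R | h₁ | yes y∈R | h₂
  with v , hs , res ← skip (λ _ → y∈R)
  = v , by-wp (h₁ ▸ h₂ ▸ hs ▸ refl , scan-next two-mem) , res
  where open ScanLengths L T H ((x , y) ∷ G) lq p lM
... | yes x∈R | h₁ | no y∉R | h₂
  with v , hs , res ← add x∈R
  = v , by-wp (h₁ ▸ h₂ ▸ rev-computes H G ▸ hs ▸ refl , bound) , res
  where
  open ScanLengths L T H ((x , y) ∷ G) lq p lM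
  bound : scanCost B M q (length (H ʳ++ G)) + (1 + length H
            + (memCost B (length (reached L T)) + (memCost B (length (reached L T)) + 1)))
          ≤ scanCost B M (suc q) (suc (length G))
  bound = subst (λ g → scanCost B M q g + _ ≤ scanCost B M (suc q) (suc (length G)))
    (sym (length-restart G H (suc-injective lq)))
    (scan-restart (≤-trans (n≤1+n q) q≤M) two-mem+rev)

-- Induction on the number `q` of edges outside the forest and then on `G`. Inspected edges are
-- known to be closed only with respect to the current reached set, so a new node sends all of them
-- back to be inspected again.
scan-computes : ∀ M q (G H T : List (Edge B)) (L : List (Node B)) {G₀} →
                length G + length H ≡ q → length L + length G₀ ≤ M →
                Forest L T → G₀ ↭ G ++ (H ++ T) → All (Closed (reached L T)) H →
                ScanFrom M q G H T L G₀
scan-computes M q [] H T L lq lM F p cl = scan-last H T L lq lM F p cl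
scan-computes M (suc q) ((x , y) ∷ G) H T L lq lM F p cl = scan-edge G H T L lq lM p
  (λ c → scan-computes M (suc q) G ((x , y) ∷ H) T L (trans (+-suc _ _) lq) lM F
           (↭-trans p (↭-sym (shift (x , y) G (H ++ T)))) (c ∷ cl))
  (λ x∈R → scan-computes M q (H ʳ++ G) [] ((x , y) ∷ T) L
             (trans (+-identityʳ _) (length-restart G H (suc-injective lq))) lM (x∈R ∷ F)
             (↭-restart G H T p) [])

augmentCost : ℕ → ℕ → ℕ
augmentCost B M = scanCost B M M M

augment-computes : ∀ {M} (G : List (Edge B)) (L : List (Node B)) → length L + length G ≤ M →
  ∃[ v ] Computes scanF
           (cons (encodeEdges G) (cons nil (cons (encodeNodes L) (cons nil (encodeNodes L)))))
           v (augmentCost B M)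
         × ScanResult L G v
augment-computes {M = M} G L lM
  with v , h , res ← scan-computes M (length G) G [] [] L (+-identityʳ _) lM []
         (↭-reflexive (sym (++-identityʳ G))) []
  = v , weaken (scanCost-mono G≤M G≤M) h , res
  where
  G≤M : length G ≤ M
  G≤M = ≤-trans (m≤n+m _ (length L)) lM

-- Persistency and branching

Complementary : NodeSet B → Set
Complementary A = ∀ x → A (~ x) ≡ not (A x)

-- Complementary sets are assignments; an assignment leaves the two edges of
-- exactly those clauses that it violates.
Feasible : List (Edge B) → List (Node B) → ℕ → Set
Feasible G L r = ∃[ A ] Complementary A × (∀ {x} → x ∈ L → A x ≡ true) × δ G A ≤ r

mirror : NodeSet B → NodeSet B
mirror S x = not (S (~ x))

-- Reversing a path destroys the skew symmetry of the implication graph, but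
-- not this consequence, which is all that persistency needs.
Symmetric : List (Edge B) → List (Node B) → Set
Symmetric G L = ∀ S → Separates S L → δ G (mirror S) ≡ δ G S

complementary-separates : {A : NodeSet B} {L : List (Node B)} →
  Complementary A → (∀ {x} → x ∈ L → A x ≡ true) → Separates A L
complementary-separates c h {x} x∈L = h x∈L , trans (c x) (cong not (h x∈L))

mirror-separates : (S : NodeSet B) {L : List (Node B)} → Separates S L → Separates (mirror S) L
mirror-separates S s {x} x∈L =
  cong not (proj₂ (s x∈L)) , cong not (trans (cong S (~-involutive x)) (proj₁ (s x∈L)))

Symmetric-⊆ : (G : List (Edge B)) {L L′ : List (Node B)} →
              (∀ {x} → x ∈ L → x ∈ L′) → Symmetric G L → Symmetric G L′
Symmetric-⊆ G L⊆L′ sy S s = sy S (s ∘ L⊆L′)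

Symmetric-augmented : {G G′ : List (Edge B)} {L : List (Node B)} →
                      Augmented L G G′ → Symmetric G L → Symmetric G′ L
Symmetric-augmented a sy S s = suc-injective
  (trans (cut-decreases a (mirror S) (mirror-separates S s))
         (trans (sy S s) (sym (cut-decreases a S s))))

leaving-∧ : ∀ a b c d → leaving (a ∧ c) (b ∧ d) ≤ leaving a b + leaving c d
leaving-∧ false _     _     _     = z≤n
leaving-∧ true  _     false _     = z≤n
leaving-∧ true  false true  _     = s≤s z≤n
leaving-∧ true  true  true  false = s≤s z≤n
leaving-∧ true  true  true  true  = z≤n

leaving-∨ : ∀ a b c d → leaving (a ∨ c) (b ∨ d) ≤ leaving a b + leaving c d
leaving-∨ true  true  _     _     = z≤n
leaving-∨ true  false _     true  = z≤n
leaving-∨ true  false _     false = s≤s z≤n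
leaving-∨ false true  true  _     = z≤n
leaving-∨ false true  false _     = z≤n
leaving-∨ false false _     _     = ≤-refl

-- An edge that leaves an intersection or a union leaves one of the two sets. This is weaker than
-- submodularity of cuts but suffices here, since at least one of the two cuts always has value 0.
δ-subadditive : (_⊕_ : Bool → Bool → Bool) →
  (∀ a b c d → leaving (a ⊕ c) (b ⊕ d) ≤ leaving a b + leaving c d) →
  (G : List (Edge B)) (S T : NodeSet B) → δ G (λ x → S x ⊕ T x) ≤ δ G S + δ G T
δ-subadditive _⊕_ sub []            S T = z≤n
δ-subadditive _⊕_ sub ((x , y) ∷ G) S T = ≤-trans
  (+-mono-≤ (sub (S x) (S y) (T x) (T y)) (δ-subadditive _⊕_ sub G S T))
  (≤-reflexive (interchange (leaving (S x) (S y)) (leaving (T x) (T y)) (δ G S) (δ G T)))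
  where
  interchange : ∀ a b c d → a + b + (c + d) ≡ a + c + (b + d)
  interchange = solve-∀

-- Here `a`, `p`, `q` stand for `A x`, `R x`, `R (~ x)`. The overriding set cannot contain both `x`
-- and `~ x`, so the two overrides never conflict.
override-complementary : ∀ a p q → (not a ∨ (q ∧ not p)) ∧ not (p ∧ not q) ≡
                                   not ((a ∨ (p ∧ not q)) ∧ not (q ∧ not p))
override-complementary true  true  true  = refl
override-complementary true  true  false = refl
override-complementary true  false true  = refl
override-complementary true  false false = refl
override-complementary false true  true  = refl
override-complementary false true  false = refl
override-complementary false false true  = refl
override-complementary false false false = refl

-- The nodes of R whose negation is not in R form a cut of value 0, which may
-- override any assignment without violating further clauses.
persistent : (G : List (Edge B)) {L L′ : List (Node B)} {r : ℕ} →
             (∀ {x} → x ∈ L → x ∈ L′) → Symmetric G L →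
             (R : NodeSet B) → Separates R L′ → δ G R ≡ 0 →
             Feasible G L r → Feasible G L′ r
persistent {B} G {L} {L′} {r} L⊆L′ sy R sR δR (A , cA , _ , δA) = A′ , cA′ , A′-true , ≤-trans δA′ δA
  where
  T A′ : NodeSet B
  T x = R x ∧ mirror R x
  A′ x = (A x ∨ T x) ∧ mirror T x

  T-separates : Separates T L′
  T-separates {x} x∈ with p , q ← sR x∈ rewrite ~-involutive x | p | q = refl , refl

  -- `R` separates `L′` and hence `L`, so symmetry gives its mirror image the value 0 as well.
  δT : δ G T ≡ 0
  δT = n≤0⇒n≡0 (≤-trans (δ-subadditive _∧_ leaving-∧ G R (mirror R))
    (≤-reflexive (cong₂ _+_ δR (trans (sy R (sR ∘ L⊆L′)) δR))))

  A′-true : ∀ {x} → x ∈ L′ → A′ x ≡ true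
  A′-true {x} x∈ with p , q ← T-separates x∈ rewrite p | q with A x
  ... | true  = refl
  ... | false = refl

  cA′ : Complementary A′
  cA′ x rewrite ~-involutive (~ x) | ~-involutive x | cA x = override-complementary (A x) (R x) (R (~ x))

  δA′ : δ G A′ ≤ δ G A
  δA′ = begin
    δ G A′                                       ≤⟨ δ-subadditive _∧_ leaving-∧ G _ (mirror T) ⟩
    δ G (λ x → A x ∨ T x) + δ G (mirror T)       ≤⟨ +-monoˡ-≤ _ (δ-subadditive _∨_ leaving-∨ G A T) ⟩
    δ G A + δ G T + δ G (mirror T)               ≡⟨ cong₂ (λ m n → δ G A + m + n) δT
                                                       (trans (sy T (T-separates ∘ L⊆L′)) δT) ⟩
    δ G A + 0 + 0                                ≡⟨ trans (+-identityʳ _) (+-identityʳ _) ⟩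
    δ G A                                        ∎
    where open ≤-Reasoning

Feasible-⊆ : (G : List (Edge B)) {L L′ : List (Node B)} {r : ℕ} →
             (∀ {x} → x ∈ L → x ∈ L′) → Feasible G L′ r → Feasible G L r
Feasible-⊆ G L⊆L′ (A , c , t , p) = A , c , t ∘ L⊆L′ , p

Feasible-branch : (G : List (Edge B)) {L : List (Node B)} {r : ℕ} (u : Node B) →
                  Feasible G L r → Feasible G (u ∷ L) r ⊎ Feasible G (~ u ∷ L) r
Feasible-branch G u (A , c , t , p) with A u in eq
... | true  = inj₁ (A , c , (λ { (here refl) → eq ; (there q) → t q }) , p)
... | false = inj₂ (A , c , (λ { (here refl) → trans (c u) (cong not eq) ; (there q) → t q }) , p)

Feasible-augmented⁺ : {G G′ : List (Edge B)} {L : List (Node B)} {r : ℕ} → Augmented L G G′ →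
                      Feasible G′ L r → Feasible G L (suc r)
Feasible-augmented⁺ a (A , c , t , p) = A , c , t ,
  ≤-trans (≤-reflexive (sym (cut-decreases a A (complementary-separates c t)))) (s≤s p)

Feasible-augmented⁻ : {G G′ : List (Edge B)} {L : List (Node B)} {r : ℕ} → Augmented L G G′ →
                      Feasible G L (suc r) → Feasible G′ L r
Feasible-augmented⁻ a (A , c , t , p) = A , c , t ,
  s≤s⁻¹ (≤-trans (≤-reflexive (cut-decreases a A (complementary-separates c t))) p)

¬Feasible-augmented : {G G′ : List (Edge B)} {L : List (Node B)} → Augmented L G G′ →
                      ¬ Feasible G L 0
¬Feasible-augmented a (A , c , t , p)
  with () ← ≤-trans (≤-reflexive (cut-decreases a A (complementary-separates c t))) p

-- Reading off an assignment when every node is decided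

Listed : List (Node B) → Node B → Set
Listed X x = x ∈ X ⊎ ~ x ∈ X

-- Both endpoints satisfy the same condition, so the invariant survives the reversal of edges. Once
-- `U` is empty, it says that `L` decides every endpoint.
Covered : (U L : List (Node B)) → Edge B → Set
Covered U L (x , y) = (Listed U x ⊎ Listed L x) × (Listed U y ⊎ Listed L y)

Covered-sym : {U L : List (Node B)} {x y : Node B} → Covered U L (x , y) → Covered U L (y , x)
Covered-sym (p , q) = q , p

Listed-decide : {U L : List (Node B)} {x : Node B} (u v : Node B) → v ≡ u ⊎ v ≡ ~ u →
                Listed (u ∷ U) x ⊎ Listed L x → Listed U x ⊎ Listed (v ∷ L) x
Listed-decide u v (inj₁ refl) (inj₁ (inj₁ (here p)))  = inj₂ (inj₁ (here p))
Listed-decide u v (inj₁ refl) (inj₁ (inj₂ (here p)))  = inj₂ (inj₂ (here p))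
Listed-decide u v (inj₂ refl) (inj₁ (inj₁ (here p)))  = inj₂ (inj₂ (here (cong ~_ p)))
Listed-decide {x = x} u v (inj₂ refl) (inj₁ (inj₂ (here p))) =
  inj₂ (inj₁ (here (trans (sym (~-involutive x)) (cong ~_ p))))
Listed-decide u v _ (inj₁ (inj₁ (there p))) = inj₁ (inj₁ p)
Listed-decide u v _ (inj₁ (inj₂ (there p))) = inj₁ (inj₂ p)
Listed-decide u v _ (inj₂ (inj₁ p))         = inj₂ (inj₁ (there p))
Listed-decide u v _ (inj₂ (inj₂ p))         = inj₂ (inj₂ (there p))

Covered-decide : {U L : List (Node B)} (u v : Node B) → v ≡ u ⊎ v ≡ ~ u →
                 {G : List (Edge B)} → All (Covered (u ∷ U) L) G → All (Covered U (v ∷ L)) G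
Covered-decide u v d = All.map λ (p , q) → Listed-decide u v d p , Listed-decide u v d q

closed-edges : (G : List (Edge B)) {S : NodeSet B} → δ G S ≡ 0 →
               All (λ (x , y) → S x ≡ true → S y ≡ true) G
closed-edges []            p = []
closed-edges ((x , y) ∷ G) {S} p with S x in ex | S y in ey
... | true  | true  = (λ _ → ey) ∷ closed-edges G p
... | false | _     = (λ p → case trans (sym ex) p of λ ()) ∷ closed-edges G p
... | true  | false with () ← p

-- The cut `R` shows that `L` is consistent. An edge that leaves `A` would lead from some `x` in `L`
-- to some `y` with `~ y` in `L`, hence from inside `R` to outside, against `δ G R ≡ 0`.
complete : {G : List (Edge B)} {L : List (Node B)} {r : ℕ} → All (Covered [] L) G →
           (R : NodeSet B) → Separates R L → δ G R ≡ 0 → Feasible G L r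
complete {B} {G} {L} {r} cov R sR δR = A , cA , A-true , ≤-trans (≤-reflexive (δA cov (closed-edges G δR))) z≤n
  where
  -- Determined by the positive node of each pair, so that `A` is complementary even where `L`
  -- decides nothing.
  A : NodeSet B
  A (node true  n p) = χ L (node true n p)
  A (node false n p) = not (χ L (node true n p))

  cA : Complementary A
  cA (node true  n p) = refl
  cA (node false n p) = sym (not-involutive _)

  exclusive : ∀ {x} → x ∈ L → ¬ ~ x ∈ L
  exclusive x∈L ~x∈L = case trans (sym (proj₁ (sR ~x∈L))) (proj₂ (sR x∈L)) of λ ()

  A-true : ∀ {x} → x ∈ L → A x ≡ true
  A-true {node true  n p} x∈L = χ⁺ x∈L
  A-true {node false n p} x∈L = cong not (χ⁻ λ q → exclusive q x∈L)

  A-true⁻ : ∀ {x} → Listed [] x ⊎ Listed L x → A x ≡ true → x ∈ L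
  A-true⁻ (inj₁ (inj₁ ())) _
  A-true⁻ (inj₁ (inj₂ ())) _
  A-true⁻ (inj₂ (inj₁ x∈L)) _ = x∈L
  A-true⁻ {x} (inj₂ (inj₂ ~x∈L)) q =
    case trans (sym (cong not q)) (trans (sym (cA x)) (A-true ~x∈L)) of λ ()

  δA : ∀ {G} → All (Covered [] L) G → All (λ (x , y) → R x ≡ true → R y ≡ true) G → δ G A ≡ 0
  δA [] [] = refl
  δA {(x , y) ∷ G} ((cx , cy) ∷ cs) (r ∷ rs) with A x in ex
  ... | false = δA cs rs
  ... | true with y∈L cy
    where
    y∈L : Listed [] y ⊎ Listed L y → y ∈ L
    y∈L (inj₁ (inj₁ ()))
    y∈L (inj₁ (inj₂ ()))
    y∈L (inj₂ (inj₁ q)) = q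
    y∈L (inj₂ (inj₂ q)) =
      case trans (sym (r (proj₁ (sR (A-true⁻ cx ex)))))
                 (trans (cong R (sym (~-involutive y))) (proj₂ (sR q))) of λ ()
  ...   | y∈ rewrite A-true y∈ = δA cs rs

-- Cost and correctness of the branching

opaque
  -- The cost of a call of solve, its recursive calls excepted.
  solveUnit : ℕ → ℕ → ℕ
  solveUnit B M = augmentCost B M + (1 + (augmentCost B M + (augmentCost B M + 1)))

  -- The recursion tree has at most `2 ^ r` leaves, since both branches lower `r`, and at most
  -- `1 + u + r` calls on each path from its root, since every call lowers `u` or `r`.
  solveCost : ℕ → ℕ → ℕ → ℕ → ℕ
  solveCost B M u r = (1 + u + r) * (2 ^ r * solveUnit B M)

  three≤solveUnit : ∀ {B M} → augmentCost B M + (1 + (augmentCost B M + (augmentCost B M + 1))) ≤ solveUnit B M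
  three≤solveUnit = ≤-refl

  unit≤2^r*unit : ∀ {B M} r → solveUnit B M ≤ 2 ^ r * solveUnit B M
  unit≤2^r*unit {B} {M} r = m≤n*m (solveUnit B M) (2 ^ r) {{m^n≢0 2 r}}

  solve-end : ∀ {M u r a} → a ≤ solveUnit B M → a ≤ solveCost B M u r
  solve-end {B} {M} {u} {r} p = one-more {m = 0} {n = 1 + u + r} (2 ^ r * solveUnit B M)
    (≤-trans p (unit≤2^r*unit {B} {M} r)) (s≤s z≤n)

  solve-decide : ∀ {M u r a} → a ≤ solveUnit B M → solveCost B M u r + a ≤ solveCost B M (suc u) r
  solve-decide {B} {M} {u} {r} p = one-more {m = 1 + u + r} {n = 2 + u + r} (2 ^ r * solveUnit B M)
    (≤-trans p (unit≤2^r*unit {B} {M} r)) ≤-refl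

  solve-augment : ∀ {M u r a} → a ≤ solveUnit B M → solveCost B M u r + a ≤ solveCost B M u (suc r)
  solve-augment {B} {M} {u} {r} {a} p = begin
    (1 + u + r) * (2 ^ r * U) + a                 ≤⟨ one-more {m = 1 + u + r} {n = 1 + u + suc r} (2 ^ r * U)
                                                       (≤-trans p (unit≤2^r*unit {B} {M} r))
                                                       (≤-reflexive (cong suc (sym (+-suc u r)))) ⟩
    (1 + u + suc r) * (2 ^ r * U)                 ≤⟨ *-monoʳ-≤ (1 + u + suc r)
                                                       (*-monoˡ-≤ U (m≤m+n (2 ^ r) _)) ⟩
    (1 + u + suc r) * (2 ^ suc r * U)             ∎
    where
    open ≤-Reasoning
    U : ℕ
    U = solveUnit B M

  solve-branch : ∀ {M u r a} → a ≤ solveUnit B M →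
                 solveCost B M u r + (solveCost B M u r + a) ≤ solveCost B M (suc u) (suc r)
  solve-branch {B} {M} {u} {r} {a} p = begin
    X + (X + a)                          ≤⟨ +-monoʳ-≤ X (+-monoʳ-≤ X (≤-trans p (unit≤2^r*unit {B} {M} r))) ⟩
    -- The right-hand side exceeds `2 * X` by `4 * (P * U)`; one of these four pays for the call
    -- itself, and three are slack.
    X + (X + P * U)                      ≤⟨ ≤-by (3 * (P * U)) (arith u r P U) ⟩
    (2 + u + suc r) * (2 * P * U)        ∎
    where
    open ≤-Reasoning
    U P X : ℕ
    U = solveUnit B M
    P = 2 ^ r
    X = (1 + u + r) * (P * U)
    arith : ∀ u r p y → (1 + u + r) * (p * y) + ((1 + u + r) * (p * y) + p * y) + 3 * (p * y)
                        ≡ (2 + u + (1 + r)) * (2 * p * y)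
    arith = solve-∀

two≤solveUnit : ∀ {M} → augmentCost B M + (augmentCost B M + 1) ≤ solveUnit B M
two≤solveUnit {B} {M} = ≤-trans (m≤n+m _ 1) (≤-trans (m≤n+m _ (augmentCost B M)) three≤solveUnit)

one≤solveUnit : ∀ {M} → augmentCost B M + 1 ≤ solveUnit B M
one≤solveUnit {B} {M} = ≤-trans (m≤n+m _ (augmentCost B M)) two≤solveUnit

map-Reflects : {P Q : Set} {b : Bool} → (P → Q) → (Q → P) → Reflects P b → Reflects Q b
map-Reflects f g (ofʸ p)  = ofʸ (f p)
map-Reflects f g (ofⁿ ¬p) = ofⁿ (¬p ∘ g)

Solves : ℕ → List (Node B) → ℕ → List (Edge B) → List (Node B) → Set
Solves {B} M U r G L = ∃[ b ]
  Computes solveF (cons (encodeNodes U) (cons (encodeUnary r) (cons (encodeEdges G) (encodeNodes L))))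
    (encodeBool b) (solveCost B M (length U) r)
  × Reflects (Feasible G L r) b

-- Induction on a bound `n` for `length U + r`, as every recursive call decides a node or spends a
-- unit. `M` can stay fixed: deciding moves a node, possibly negated, from `U` to `L`, and
-- augmenting keeps the number of edges.
solve-computes : ∀ {M} n (U : List (Node B)) r (G : List (Edge B)) (L : List (Node B)) →
  length U + r < n → length U + (length L + length G) ≤ M → Symmetric G L → All (Covered U L) G →
  Solves M U r G L
solve-computes (suc n) U r G L lt lM sy cov
  with augment-computes G L (≤-trans (m≤n+m _ (length U)) lM)
solve-computes (suc n) U zero G L lt lM sy cov | _ , h , augmented a =
  false , by-wp (h ▸ refl , solve-end one≤solveUnit) , ofⁿ (¬Feasible-augmented a)
solve-computes {M = M} (suc n) U (suc r) G L lt lM sy cov | _ , h , augmented {G′} a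
  with b , hs , reflects ← solve-computes {M = M} n U r G′ L
         (s≤s⁻¹ (subst (_< suc n) (+-suc (length U) r) lt))
         (≤-trans (≤-reflexive (cong (λ g → length U + (length L + g)) (same-length a))) lM)
         (Symmetric-augmented a sy) (preserves a Covered-sym cov)
  = b , by-wp (h ▸ hs ▸ refl , solve-augment one≤solveUnit) ,
    map-Reflects (Feasible-augmented⁺ a) (Feasible-augmented⁻ a) reflects
solve-computes (suc n) [] r G L lt lM sy cov | _ , h , closed R sR δR =
  true , by-wp (h ▸ refl , solve-end one≤solveUnit) , ofʸ (complete cov R sR δR)
solve-computes {M = M} (suc n) (u ∷ U) r G L lt lM sy cov | _ , h , closed R sR δR
  with augment-computes {M = M} G (u ∷ L) (decided u)
  where
  decided : (v : Node _) → length (v ∷ L) + length G ≤ M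
  decided v = ≤-trans (s≤s (m≤n+m _ (length U))) lM
... | _ , h₁ , closed R₁ sR₁ δR₁
  with b , hs , reflects ← solve-computes {M = M} n U r G (u ∷ L)
         (s≤s⁻¹ lt) (≤-trans (≤-reflexive (+-suc (length U) _)) lM)
         (Symmetric-⊆ G there sy) (Covered-decide u u (inj₁ refl) cov)
  = b , by-wp (h ▸ h₁ ▸ hs ▸ refl , solve-decide two≤solveUnit) ,
    map-Reflects (Feasible-⊆ G there) (persistent G there sy R₁ sR₁ δR₁) reflects
... | _ , h₁ , augmented {G₁} a₁
  with augment-computes {M = M} G (~ u ∷ L) (≤-trans (s≤s (m≤n+m _ (length U))) lM)
...   | _ , h₂ , closed R₂ sR₂ δR₂
  with b , hs , reflects ← solve-computes {M = M} n U r G (~ u ∷ L)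
         (s≤s⁻¹ lt) (≤-trans (≤-reflexive (+-suc (length U) _)) lM)
         (Symmetric-⊆ G there sy) (Covered-decide u (~ u) (inj₂ refl) cov)
  = b , by-wp (h ▸ h₁ ▸ neg-computes u ▸ h₂ ▸ hs ▸ refl , solve-decide three≤solveUnit) ,
    map-Reflects (Feasible-⊆ G there) (persistent G there sy R₂ sR₂ δR₂) reflects
solve-computes {M = M} (suc n) (u ∷ U) zero G L lt lM sy cov
  | _ , h , closed R sR δR | _ , h₁ , augmented {G₁} a₁ | _ , h₂ , augmented {G₂} a₂ =
  false , by-wp (h ▸ h₁ ▸ neg-computes u ▸ h₂ ▸ refl , solve-end three≤solveUnit) , ofⁿ λ f →
    case Feasible-branch G u f of λ
      { (inj₁ p) → ¬Feasible-augmented a₁ p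
      ; (inj₂ p) → ¬Feasible-augmented a₂ p }
solve-computes {M = M} (suc n) (u ∷ U) (suc r) G L lt lM sy cov
  | _ , h , closed R sR δR | _ , h₁ , augmented {G₁} a₁ | _ , h₂ , augmented {G₂} a₂
  with solve-computes {M = M} n U r G₁ (u ∷ L)
         (≤-trans (s≤s (+-monoʳ-≤ (length U) (n≤1+n r))) (s≤s⁻¹ lt))
         (≤-trans (≤-reflexive (cong (λ g → length U + suc (length L + g)) (same-length a₁)))
                  (≤-trans (≤-reflexive (+-suc (length U) _)) lM))
         (Symmetric-augmented a₁ (Symmetric-⊆ G there sy))
         (preserves a₁ Covered-sym (Covered-decide u u (inj₁ refl) cov))
... | true , hs , ofʸ p =
  true , by-wp (h ▸ h₁ ▸ neg-computes u ▸ h₂ ▸ hs ▸ refl ,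
                ≤-trans (m≤n+m _ (solveCost _ M (length U) r)) (solve-branch three≤solveUnit)) ,
  ofʸ (Feasible-⊆ G there (Feasible-augmented⁺ a₁ p))
... | false , hs₁ , ofⁿ ¬p
  with b , hs₂ , reflects ← solve-computes {M = M} n U r G₂ (~ u ∷ L)
         (≤-trans (s≤s (+-monoʳ-≤ (length U) (n≤1+n r))) (s≤s⁻¹ lt))
         (≤-trans (≤-reflexive (cong (λ g → length U + suc (length L + g)) (same-length a₂)))
                  (≤-trans (≤-reflexive (+-suc (length U) _)) lM))
         (Symmetric-augmented a₂ (Symmetric-⊆ G there sy))
         (preserves a₂ Covered-sym (Covered-decide u (~ u) (inj₂ refl) cov))
  = b , by-wp (h ▸ h₁ ▸ neg-computes u ▸ h₂ ▸ hs₁ ▸ hs₂ ▸ refl , solve-branch three≤solveUnit) ,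
    map-Reflects (Feasible-⊆ G there ∘ Feasible-augmented⁺ a₂)
      (λ f → case Feasible-branch G u f of λ
        { (inj₁ p) → contradiction (Feasible-augmented⁻ a₁ p) ¬p
        ; (inj₂ p) → Feasible-augmented⁻ a₂ p }) reflects

-- Instances

nameOf : Literal → Tree
nameOf (pos x) = encodeℕ x
nameOf (neg x) = encodeℕ x

isPositive : Literal → Bool
isPositive (pos x) = true
isPositive (neg x) = false

Small : ℕ → Literal → Set
Small N l = size (nameOf l) ≤ N

-- The constant 11 is `4 + size ⊤name`, so that `⊤node` fits whatever `N` is.
literalNode : ∀ {N} (l : Literal) → Small N l → Node (11 + N)
literalNode l s = node (isPositive l) (nameOf l) (+-mono-≤ {4} {11} (m≤m+n 4 7) s)

⊤node ⊥node : ∀ {N} → Node (11 + N)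
⊤node = node true ⊤name (m≤m+n 11 _)
⊥node = ~ ⊤node

-- Clauses with fewer than two literals are padded with the constant false.
padded : ∀ {N} (C : Clause) → length C ≤ 2 → All (Small N) C → Node (11 + N) × Node (11 + N)
padded []          _ _            = ⊥node , ⊥node
padded (l ∷ [])    _ (s ∷ [])     = literalNode l s , ⊥node
padded (l ∷ m ∷ C) _ (s ∷ t ∷ ss) = literalNode l s , literalNode m t

-- For the empty clause both edges lead from `⊤node` to `⊥node`, so every complementary set
-- containing `⊤node` pays 2, as for any violated clause.
clauseEdges : Node B × Node B → List (Edge B)
clauseEdges (a , b) = (~ a , b) ∷ (~ b , a) ∷ []

edgesOf : ∀ {N} (Φ : CNF) → Is2CNF Φ → All (All (Small N)) Φ → List (Edge (11 + N))
edgesOf []      []       []       = []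
edgesOf (C ∷ Φ) (p ∷ ps) (s ∷ ss) = clauseEdges (padded C p s) ++ edgesOf Φ ps ss

encodeCNF : CNF → Tree
encodeCNF = encodeList (encodeList encodeLiteral)

length-edgesOf : ∀ {N} (Φ : CNF) ps (ss : All (All (Small N)) Φ) →
                 length (edgesOf Φ ps ss) ≡ 2 * length Φ
length-edgesOf []      []       []       = refl
length-edgesOf (C ∷ Φ) (p ∷ ps) (s ∷ ss) = trans (cong (2 +_) (length-edgesOf Φ ps ss)) (sym (*-suc 2 (length Φ)))

edges-computes : ∀ {N} (Φ : CNF) ps (ss : All (All (Small N)) Φ) →
                 Computes edgesF (encodeCNF Φ) (encodeEdges (edgesOf Φ ps ss)) (1 + 3 * length Φ)
edges-computes [] [] [] = by-wp (refl , ≤-refl)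
edges-computes {N} (C ∷ Φ) (p ∷ ps) (s ∷ ss) = clause C p s
  where
  rest = edges-computes Φ ps ss
  bound : 1 + 3 * length Φ + 3 ≤ 1 + 3 * length (C ∷ Φ)
  bound = ≤-reflexive (arith (length Φ))
    where
    arith : ∀ n → 1 + 3 * n + 3 ≡ 1 + 3 * (1 + n)
    arith = solve-∀
  clause : ∀ C p s → Computes edgesF (encodeCNF (C ∷ Φ)) (encodeEdges (edgesOf (C ∷ Φ) (p ∷ ps) (s ∷ ss)))
                              (1 + 3 * length (C ∷ Φ))
  clause [] _ [] = by-wp (neg-computes {B = 11 + N} ⊥node ▸ neg-computes {B = 11 + N} ⊥node ▸ rest ▸ refl , bound)
  clause (pos x ∷ []) _ (s ∷ []) =
    by-wp (neg-computes (literalNode (pos x) s) ▸ neg-computes {B = 11 + N} ⊥node ▸ rest ▸ refl , bound)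
  clause (neg x ∷ []) _ (s ∷ []) =
    by-wp (neg-computes (literalNode (neg x) s) ▸ neg-computes {B = 11 + N} ⊥node ▸ rest ▸ refl , bound)
  clause (pos x ∷ pos y ∷ []) _ (s ∷ t ∷ []) =
    by-wp (neg-computes (literalNode (pos x) s) ▸ neg-computes (literalNode (pos y) t) ▸ rest ▸ refl , bound)
  clause (pos x ∷ neg y ∷ []) _ (s ∷ t ∷ []) =
    by-wp (neg-computes (literalNode (pos x) s) ▸ neg-computes (literalNode (neg y) t) ▸ rest ▸ refl , bound)
  clause (neg x ∷ pos y ∷ []) _ (s ∷ t ∷ []) =
    by-wp (neg-computes (literalNode (neg x) s) ▸ neg-computes (literalNode (pos y) t) ▸ rest ▸ refl , bound)
  clause (neg x ∷ neg y ∷ []) _ (s ∷ t ∷ []) =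
    by-wp (neg-computes (literalNode (neg x) s) ▸ neg-computes (literalNode (neg y) t) ▸ rest ▸ refl , bound)
  clause (_ ∷ _ ∷ _ ∷ _) (s≤s (s≤s ())) _

heads-computes : (G : List (Edge B)) →
                 Computes headsF (encodeEdges G) (encodeNodes (map proj₂ G)) (1 + length G)
heads-computes []      = by-wp (refl , ≤-refl)
heads-computes (e ∷ G) = by-wp (heads-computes G ▸ refl , ≤-reflexive (+-comm _ 1))

-- The budget in unary

bits : ℕᵇ → ℕ
bits ℕᵇ.zero  = 0
bits 2[1+ b ] = suc (bits b)
bits 1+[2 b ] = suc (bits b)

bits≤size : ∀ b → bits b ≤ size (encodeℕᵇ b)
bits≤size ℕᵇ.zero  = z≤n
bits≤size 2[1+ b ] = s≤s (≤-trans (bits≤size b) (m≤n+m _ 1))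
bits≤size 1+[2 b ] = s≤s (≤-trans (bits≤size b) (m≤n+m _ 3))

bits-double : ∀ b → bits (ℕᵇ.double b) ≤ suc (bits b)
bits-double ℕᵇ.zero  = z≤n
bits-double 2[1+ b ] = ≤-refl
bits-double 1+[2 b ] = s≤s (bits-double b)

double-computes : ∀ b → Computes doubleF (encodeℕᵇ b) (encodeℕᵇ (ℕᵇ.double b)) (1 + bits b)
double-computes ℕᵇ.zero  = by-wp (refl , ≤-refl)
double-computes 2[1+ b ] = by-wp (refl , s≤s z≤n)
double-computes 1+[2 b ] = by-wp (double-computes b ▸ refl , ≤-reflexive (+-comm _ 1))

-- Truncation at the number of clauses changes no answer, because no deletion set is larger, and
-- keeps the unary budget linear in the input size.
budget : ℕ → ℕ → ℕ
budget zero    n       = 0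
budget (suc k) zero    = 0
budget (suc k) (suc n) = suc (suc (budget k n))

budget≡ : ∀ k n → budget k n ≡ 2 * (k ⊓ n)
budget≡ zero    n       = refl
budget≡ (suc k) zero    = refl
budget≡ (suc k) (suc n) = trans (cong (2 +_) (budget≡ k n)) (sym (*-suc 2 (k ⊓ n)))

budgetCost : ℕ → ℕ → ℕ
budgetCost K n = 1 + n * (1 + K)

-- Taking the predecessor never lengthens a number, so the same `K` bounds every step of the
-- countdown.
budget-computes : ∀ {K} k (Φ : CNF) → bits k ≤ K →
                  Computes budgetF (cons (encodeℕᵇ k) (encodeCNF Φ))
                           (encodeUnary (budget (ℕᵇ.toℕ k) (length Φ))) (budgetCost K (length Φ))
budget-computes ℕᵇ.zero  Φ       _ = by-wp (refl , s≤s z≤n)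
budget-computes 2[1+ b ] []      _ = by-wp (refl , ≤-refl)
budget-computes 1+[2 b ] []      _ = by-wp (refl , ≤-refl)
budget-computes {K} 2[1+ b ] (C ∷ Φ) bits≤K =
  by-wp (budget-computes {K} 1+[2 b ] Φ bits≤K ▸
         cong (λ k → encodeUnary (2 + budget k (length Φ))) (ℕᵇ.toℕ-pred 2[1+ b ]) ,
         ≤-by K (arith (length Φ) K))
  where
  arith : ∀ n k → 1 + n * (1 + k) + 1 + k ≡ 1 + (1 + n) * (1 + k)
  arith = solve-∀
budget-computes {K} 1+[2 b ] (C ∷ Φ) bits≤K =
  by-wp (double-computes b ▸ budget-computes {K} (ℕᵇ.double b) Φ (≤-trans (bits-double b) bits≤K) ▸
         cong (λ k → encodeUnary (2 + budget k (length Φ))) (ℕᵇ.toℕ-double b) , (begin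
    budgetCost K (length Φ) + (1 + bits b + 1)  ≤⟨ +-monoʳ-≤ (budgetCost K (length Φ)) (+-monoˡ-≤ 1 bits≤K) ⟩
    budgetCost K (length Φ) + (K + 1)           ≡⟨ arith (length Φ) K ⟩
    budgetCost K (length (C ∷ Φ))               ∎))
  where
  open ≤-Reasoning
  arith : ∀ n k → 1 + n * (1 + k) + (k + 1) ≡ 1 + (1 + n) * (1 + k)
  arith = solve-∀

leaving-not : ∀ a b → leaving (not a) (not b) ≡ leaving b a
leaving-not true  true  = refl
leaving-not true  false = refl
leaving-not false true  = refl
leaving-not false false = refl

-- Taking the mirror image of `S` exchanges the contributions of the two edges of each clause.
edgesOf-symmetric : ∀ {N} (Φ : CNF) ps (ss : All (All (Small N)) Φ) (S : NodeSet (11 + N)) →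
                    δ (edgesOf Φ ps ss) (mirror S) ≡ δ (edgesOf Φ ps ss) S
edgesOf-symmetric []      []       []       S = refl
edgesOf-symmetric (C ∷ Φ) (p ∷ ps) (s ∷ ss) S with padded C p s
... | a , b
  rewrite ~-involutive a | ~-involutive b | leaving-not (S a) (S (~ b)) | leaving-not (S b) (S (~ a))
        | edgesOf-symmetric Φ ps ss S
  = exchange (leaving (S (~ b)) (S a)) (leaving (S (~ a)) (S b)) (δ (edgesOf Φ ps ss) S)
  where
  exchange : ∀ a b c → a + (b + c) ≡ b + (a + c)
  exchange = solve-∀

-- Each literal of a padded clause is the head of one edge and its negation the tail of the other,
-- so the heads alone represent all nodes up to negation.
edgesOf-covered : ∀ {N} (Φ : CNF) ps (ss : All (All (Small N)) Φ) {U L} →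
                  All (λ e → proj₂ e ∈ U) (edgesOf Φ ps ss) → All (Covered U L) (edgesOf Φ ps ss)
edgesOf-covered []      []       []       _             = []
edgesOf-covered (C ∷ Φ) (p ∷ ps) (s ∷ ss) (b∈U ∷ a∈U ∷ h) with padded C p s
... | a , b = (negated a a∈U , inj₁ (inj₁ b∈U)) ∷ (negated b b∈U , inj₁ (inj₁ a∈U)) ∷ edgesOf-covered Φ ps ss h
  where
  negated : ∀ {U L} x → x ∈ U → Listed U (~ x) ⊎ Listed L (~ x)
  negated x x∈U = inj₁ (inj₂ (subst (_∈ _) (sym (~-involutive x)) x∈U))

length≤size : {A : Set} (enc : A → Tree) (xs : List A) → length xs ≤ size (encodeList enc xs)
length≤size enc []       = z≤n
length≤size enc (x ∷ xs) = s≤s (≤-trans (length≤size enc xs) (m≤n+m _ _))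

elements≤size : {A : Set} (enc : A → Tree) (xs : List A) {N : ℕ} → size (encodeList enc xs) ≤ N →
                All (λ x → size (enc x) ≤ N) xs
elements≤size enc []       p = []
elements≤size enc (x ∷ xs) p =
  ≤-trans (≤-trans (m≤m+n _ _) (n≤1+n _)) p ∷
  elements≤size enc xs (≤-trans (≤-trans (m≤n+m _ _) (n≤1+n _)) p)

nameOf≤ : ∀ l → size (nameOf l) ≤ size (encodeLiteral l)
nameOf≤ (pos x) = m≤n+m _ 4
nameOf≤ (neg x) = m≤n+m _ 2

all-small : ∀ {N} (Φ : CNF) → size (encodeCNF Φ) ≤ N → All (All (Small N)) Φ
all-small Φ p = All.map
  (λ {C} q → All.map (λ {l} r → ≤-trans (nameOf≤ l) r) (elements≤size encodeLiteral C q))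
  (elements≤size (encodeList encodeLiteral) Φ p)

-- Deletion sets and cuts

satisfied-⊎ : ∀ {N} (A : NodeSet (11 + N)) (α : Assignment) →
              (∀ l s → TrueLiteral α l → A (literalNode l s) ≡ true) →
              ∀ C p s → Any (TrueLiteral α) C →
              A (proj₁ (padded C p s)) ≡ true ⊎ A (proj₂ (padded C p s)) ≡ true
satisfied-⊎ A α f (l ∷ [])    p (s ∷ [])     (here q)         = inj₁ (f l s q)
satisfied-⊎ A α f (l ∷ m ∷ C) p (s ∷ t ∷ ss) (here q)         = inj₁ (f l s q)
satisfied-⊎ A α f (l ∷ m ∷ C) p (s ∷ t ∷ ss) (there (here q)) = inj₂ (f m t q)
satisfied-⊎ A α f (_ ∷ _ ∷ _ ∷ _) (s≤s (s≤s ())) _ (there (there _))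

⊎-satisfied : ∀ {N} (A : NodeSet (11 + N)) (α : Assignment) → A ⊥node ≡ false →
              (∀ l s → A (literalNode l s) ≡ true → TrueLiteral α l) →
              ∀ C p s → A (proj₁ (padded C p s)) ≡ true ⊎ A (proj₂ (padded C p s)) ≡ true →
              Any (TrueLiteral α) C
⊎-satisfied A α ⊥f f []          p s           (inj₁ q) = case trans (sym ⊥f) q of λ ()
⊎-satisfied A α ⊥f f []          p s           (inj₂ q) = case trans (sym ⊥f) q of λ ()
⊎-satisfied A α ⊥f f (l ∷ [])    p (s ∷ [])    (inj₁ q) = here (f l s q)
⊎-satisfied A α ⊥f f (l ∷ [])    p (s ∷ [])    (inj₂ q) = case trans (sym ⊥f) q of λ ()
⊎-satisfied A α ⊥f f (l ∷ m ∷ C) p (s ∷ t ∷ _) (inj₁ q) = here (f l s q)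
⊎-satisfied A α ⊥f f (l ∷ m ∷ C) p (s ∷ t ∷ _) (inj₂ q) = there (here (f m t q))

leaving≤1 : ∀ a b → leaving a b ≤ 1
leaving≤1 true  true  = z≤n
leaving≤1 true  false = s≤s z≤n
leaving≤1 false _     = z≤n

clause-satisfied : (A : NodeSet B) → Complementary A → ∀ a b → A a ≡ true ⊎ A b ≡ true →
                   δ (clauseEdges (a , b)) A ≡ 0
clause-satisfied A c a b h rewrite c a | c b with A a | A b
... | true  | true  = refl
... | true  | false = refl
... | false | true  = refl
... | false | false with h
...   | inj₁ ()
...   | inj₂ ()

clause≤2 : (A : NodeSet B) (ab : Node B × Node B) → δ (clauseEdges ab) A ≤ 2
clause≤2 A (a , b) = +-mono-≤ (leaving≤1 (A (~ a)) (A b))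
  (≤-trans (≤-reflexive (+-identityʳ _)) (leaving≤1 (A (~ b)) (A a)))

clause-violated : (A : NodeSet B) → Complementary A → ∀ a b → A a ≡ false → A b ≡ false →
                  δ (clauseEdges (a , b)) A ≡ 2
clause-violated A c a b p q rewrite c a | c b | p | q = refl

deletion⇒cut : ∀ {N} (A : NodeSet (11 + N)) (α : Assignment) → Complementary A →
               (∀ l s → TrueLiteral α l → A (literalNode l s) ≡ true) →
               ∀ Φ ps ss (S : Subset (length Φ)) → All (Any (TrueLiteral α)) (delete Φ S) →
               δ (edgesOf Φ ps ss) A ≤ 2 * Sub.∣ S ∣
deletion⇒cut A α c f []      []       []       []            h = z≤n
deletion⇒cut A α c f (C ∷ Φ) (p ∷ ps) (s ∷ ss) (inside ∷ S)  h = begin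
  δ (clauseEdges (padded C p s) ++ edgesOf Φ ps ss) A         ≡⟨ δ-++ (clauseEdges (padded C p s)) (edgesOf Φ ps ss) A ⟩
  δ (clauseEdges (padded C p s)) A + δ (edgesOf Φ ps ss) A    ≤⟨ +-mono-≤ (clause≤2 A (padded C p s))
                                                                   (deletion⇒cut A α c f Φ ps ss S h) ⟩
  2 + 2 * Sub.∣ S ∣                                           ≡⟨ *-suc 2 Sub.∣ S ∣ ⟨
  2 * suc Sub.∣ S ∣                                           ∎
  where open ≤-Reasoning
deletion⇒cut A α c f (C ∷ Φ) (p ∷ ps) (s ∷ ss) (outside ∷ S) (h ∷ hs) = begin
  δ (clauseEdges (padded C p s) ++ edgesOf Φ ps ss) A         ≡⟨ δ-++ (clauseEdges (padded C p s)) (edgesOf Φ ps ss) A ⟩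
  δ (clauseEdges (padded C p s)) A + δ (edgesOf Φ ps ss) A    ≡⟨ cong (_+ δ (edgesOf Φ ps ss) A)
                                                                   (clause-satisfied A c _ _ (satisfied-⊎ A α f C p s h)) ⟩
  δ (edgesOf Φ ps ss) A                                       ≤⟨ deletion⇒cut A α c f Φ ps ss S hs ⟩
  2 * Sub.∣ S ∣                                               ∎
  where open ≤-Reasoning

true⊎false : ∀ b → b ≡ true ⊎ b ≡ false
true⊎false true  = inj₁ refl
true⊎false false = inj₂ refl

-- The deleted clauses are those whose two padded literals are both false in `A`; each of them
-- contributes 2 to the cut.
cut⇒deletion : ∀ {N} (A : NodeSet (11 + N)) (α : Assignment) → Complementary A → A ⊥node ≡ false →
               (∀ l s → A (literalNode l s) ≡ true → TrueLiteral α l) →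
               ∀ Φ ps ss → ∃[ S ] 2 * Sub.∣ S ∣ ≤ δ (edgesOf Φ ps ss) A × All (Any (TrueLiteral α)) (delete Φ S)
cut⇒deletion A α c ⊥f f []      []       []       = [] , z≤n , []
cut⇒deletion A α c ⊥f f (C ∷ Φ) (p ∷ ps) (s ∷ ss)
  with S , le , h ← cut⇒deletion A α c ⊥f f Φ ps ss
  with true⊎false (A (proj₁ (padded C p s))) | true⊎false (A (proj₂ (padded C p s)))
... | inj₁ ea | _ = outside ∷ S ,
  ≤-trans le (≤-trans (m≤n+m _ (δ (clauseEdges (padded C p s)) A))
                      (≤-reflexive (sym (δ-++ (clauseEdges (padded C p s)) (edgesOf Φ ps ss) A)))) ,
  ⊎-satisfied A α ⊥f f C p s (inj₁ ea) ∷ h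
... | inj₂ _ | inj₁ eb = outside ∷ S ,
  ≤-trans le (≤-trans (m≤n+m _ (δ (clauseEdges (padded C p s)) A))
                      (≤-reflexive (sym (δ-++ (clauseEdges (padded C p s)) (edgesOf Φ ps ss) A)))) ,
  ⊎-satisfied A α ⊥f f C p s (inj₂ eb) ∷ h
... | inj₂ ea | inj₂ eb = inside ∷ S , (begin
    2 * suc Sub.∣ S ∣                                           ≡⟨ *-suc 2 Sub.∣ S ∣ ⟩
    2 + 2 * Sub.∣ S ∣                                           ≤⟨ +-monoʳ-≤ 2 le ⟩
    2 + δ (edgesOf Φ ps ss) A                                   ≡⟨ cong (_+ δ (edgesOf Φ ps ss) A) (clause-violated A c _ _ ea eb) ⟨
    δ (clauseEdges (padded C p s)) A + δ (edgesOf Φ ps ss) A    ≡⟨ δ-++ (clauseEdges (padded C p s)) (edgesOf Φ ps ss) A ⟨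
    δ (clauseEdges (padded C p s) ++ edgesOf Φ ps ss) A         ∎) , h
  where open ≤-Reasoning

decode : Tree → ℕᵇ
decode nil                 = ℕᵇ.zero
decode (cons nil t)        = 2[1+ decode t ]
decode (cons (cons _ _) t) = 1+[2 decode t ]

decode-encode : ∀ b → decode (encodeℕᵇ b) ≡ b
decode-encode ℕᵇ.zero  = refl
decode-encode 2[1+ b ] = cong 2[1+_] (decode-encode b)
decode-encode 1+[2 b ] = cong 1+[2_] (decode-encode b)

-- The first clause recognises `⊤name` and matches no encoded number, because the head of such a
-- number is `nil` or `cons nil nil`.
valuation : Assignment → Tree → Bool
valuation α (cons (cons (cons _ _) _) _) = true
valuation α t                            = α (ℕᵇ.toℕ (decode t))

valuation-encode : ∀ α x → valuation α (encodeℕ x) ≡ α x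
valuation-encode α x = trans (step (ℕᵇ.fromℕ x))
  (cong α (trans (cong ℕᵇ.toℕ (decode-encode (ℕᵇ.fromℕ x))) (ℕᵇ.toℕ-fromℕ x)))
  where
  step : ∀ b → valuation α (encodeℕᵇ b) ≡ α (ℕᵇ.toℕ (decode (encodeℕᵇ b)))
  step ℕᵇ.zero  = refl
  step 2[1+ b ] = refl
  step 1+[2 b ] = refl

fromAssignment : Assignment → NodeSet B
fromAssignment α (node true  n _) = valuation α n
fromAssignment α (node false n _) = not (valuation α n)

fromAssignment-complementary : ∀ α → Complementary (fromAssignment {B} α)
fromAssignment-complementary α (node true  n _) = refl
fromAssignment-complementary α (node false n _) = sym (not-involutive _)

fromAssignment-literal : ∀ {N} α l (s : Small N l) → TrueLiteral α l → fromAssignment α (literalNode l s) ≡ true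
fromAssignment-literal α (pos x) s h = trans (valuation-encode α x) h
fromAssignment-literal α (neg x) s h = cong not (trans (valuation-encode α x) h)

toAssignment : ∀ {N} → NodeSet (11 + N) → Assignment
toAssignment {N} A x with size (encodeℕ x) ≤? N
... | yes s = A (literalNode (pos x) s)
-- A default for variables whose names are too long to occur in the formula.
... | no _  = false

toAssignment-literal : ∀ {N} (A : NodeSet (11 + N)) → Complementary A →
                       ∀ l s → A (literalNode l s) ≡ true → TrueLiteral (toAssignment A) l
toAssignment-literal {N} A c (pos x) s h with size (encodeℕ x) ≤? N
... | yes s′ = trans (cong (λ s → A (literalNode (pos x) s)) (≤-irrelevant s′ s)) h
... | no ¬s  = contradiction s ¬s
toAssignment-literal {N} A c (neg x) s h with size (encodeℕ x) ≤? N
... | no ¬s  = contradiction s ¬s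
... | yes s′ = trans (cong (λ s → A (literalNode (pos x) s)) (≤-irrelevant s′ s))
                     (trans (sym (not-involutive _)) (cong not (trans (sym (c (literalNode (pos x) s))) h)))

feasible⇔deletable : ∀ {N} (Φ : CNF) ps (ss : All (All (Small N)) Φ) k →
  let P = Feasible (edgesOf Φ ps ss) (⊤node ∷ []) (budget k (length Φ)) in
  (P → SatisfiableByDeleting Φ (ℤ.+ k)) × (SatisfiableByDeleting Φ (ℤ.+ k) → P)
feasible⇔deletable {N} Φ ps ss k = to , from
  where
  to : Feasible (edgesOf Φ ps ss) (⊤node ∷ []) (budget k (length Φ)) → SatisfiableByDeleting Φ (ℤ.+ k)
  to (A , c , t , p)
    with S , le , h ← cut⇒deletion A (toAssignment A) c (trans (c ⊤node) (cong not (t (here refl))))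
                        (toAssignment-literal A c) Φ ps ss
    = S , ℤ.+≤+ (≤-trans (*-cancelˡ-≤ 2 (begin
        2 * Sub.∣ S ∣                ≤⟨ le ⟩
        δ (edgesOf Φ ps ss) A        ≤⟨ p ⟩
        budget k (length Φ)          ≡⟨ budget≡ k (length Φ) ⟩
        2 * (k ⊓ length Φ)           ∎)) (m⊓n≤m k _)) , toAssignment A , h
    where open ≤-Reasoning
  from : SatisfiableByDeleting Φ (ℤ.+ k) → Feasible (edgesOf Φ ps ss) (⊤node ∷ []) (budget k (length Φ))
  from (S , ℤ.+≤+ S≤k , α , h) = fromAssignment α , fromAssignment-complementary α , (λ { (here refl) → refl }) , (begin
      δ (edgesOf Φ ps ss) (fromAssignment α)   ≤⟨ deletion⇒cut (fromAssignment α) α (fromAssignment-complementary α)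
                                                    (fromAssignment-literal α) Φ ps ss S h ⟩
      2 * Sub.∣ S ∣                            ≤⟨ *-monoʳ-≤ 2 (⊓-glb S≤k (Sub.∣p∣≤n S)) ⟩
      2 * (k ⊓ length Φ)                       ≡⟨ budget≡ k (length Φ) ⟨
      budget k (length Φ)                      ∎)
    where open ≤-Reasoning

-- Polynomial bounds

-- For `1 ≤ N` the power `N ^ d` is monotone in `d`, so one exponent can dominate both summands of a
-- sum.
Polynomial : (ℕ → ℕ) → Set
Polynomial f = ∃[ c ] ∃[ d ] (∀ N → 1 ≤ N → f N ≤ c * N ^ d)

poly-const : ∀ a → Polynomial (λ _ → a)
poly-const a = a , 0 , λ N _ → ≤-reflexive (sym (*-identityʳ a))

poly-id : Polynomial (λ N → N)
poly-id = 1 , 1 , λ N _ → ≤-reflexive (sym (trans (*-identityˡ _) (*-identityʳ N)))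

^-monoʳ : ∀ {N a b} → 1 ≤ N → a ≤ b → N ^ a ≤ N ^ b
^-monoʳ {suc N} _ a≤b = ^-monoʳ-≤ (suc N) a≤b

poly-+ : ∀ {f g} → Polynomial f → Polynomial g → Polynomial (λ N → f N + g N)
poly-+ {f} {g} (c , d , p) (c′ , d′ , q) = c + c′ , d + d′ , λ N 1≤N → begin
  f N + g N                                  ≤⟨ +-mono-≤ (p N 1≤N) (q N 1≤N) ⟩
  c * N ^ d + c′ * N ^ d′                    ≤⟨ +-mono-≤ (*-monoʳ-≤ c (^-monoʳ 1≤N (m≤m+n d d′)))
                                                         (*-monoʳ-≤ c′ (^-monoʳ 1≤N (m≤n+m d′ d))) ⟩
  c * N ^ (d + d′) + c′ * N ^ (d + d′)       ≡⟨ *-distribʳ-+ (N ^ (d + d′)) c c′ ⟨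
  (c + c′) * N ^ (d + d′)                    ∎
  where open ≤-Reasoning

poly-* : ∀ {f g} → Polynomial f → Polynomial g → Polynomial (λ N → f N * g N)
poly-* {f} {g} (c , d , p) (c′ , d′ , q) = c * c′ , d + d′ , λ N 1≤N → begin
  f N * g N                          ≤⟨ *-mono-≤ (p N 1≤N) (q N 1≤N) ⟩
  c * N ^ d * (c′ * N ^ d′)          ≡⟨ interchange c (N ^ d) c′ (N ^ d′) ⟩
  c * c′ * (N ^ d * N ^ d′)          ≡⟨ cong (c * c′ *_) (^-distribˡ-+-* N d d′) ⟨
  c * c′ * N ^ (d + d′)              ∎
  where
  open ≤-Reasoning
  interchange : ∀ a b c d → a * b * (c * d) ≡ a * c * (b * d)
  interchange = solve-∀

memCost-poly : ∀ {f g} → Polynomial f → Polynomial g → Polynomial (λ N → memCost (f N) (g N))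
memCost-poly f g = poly-+ (poly-const 1) (poly-* g (poly-+ (poly-const 1) f))

opaque
  unfolding scanUnit

  augmentCost-poly : ∀ {f g} → Polynomial f → Polynomial g → Polynomial (λ N → augmentCost (f N) (g N))
  augmentCost-poly {f} {g} pf pg = poly-* (poly-+ 1+g (poly-* pg 1+g))
    (poly-+ (poly-+ 1+g (poly-+ mem (poly-+ mem (poly-const 1))))
      (poly-+ mem (poly-+ (poly-+ (poly-const 1) (poly-* pg (poly-+ (poly-const 2) mem))) (poly-const 1))))
    where
    1+g : Polynomial (λ N → 1 + g N)
    1+g = poly-+ (poly-const 1) pg
    mem : Polynomial (λ N → memCost (f N) (g N))
    mem = memCost-poly pf pg

opaque
  unfolding solveUnit

  solveUnit-poly : ∀ {f g} → Polynomial f → Polynomial g → Polynomial (λ N → solveUnit (f N) (g N))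
  solveUnit-poly {f} {g} pf pg = poly-+ aug (poly-+ (poly-const 1) (poly-+ aug (poly-+ aug (poly-const 1))))
    where
    aug : Polynomial (λ N → augmentCost (f N) (g N))
    aug = augmentCost-poly pf pg

  solveCost-bound : ∀ {M u r} → solveCost B M u r ≤ (1 + u + r) * (2 ^ r * solveUnit B M)
  solveCost-bound = ≤-refl

2^budget≤4^k : ∀ k n → 2 ^ budget k n ≤ 4 ^ k
2^budget≤4^k k n = begin
  2 ^ budget k n       ≡⟨ cong (2 ^_) (budget≡ k n) ⟩
  2 ^ (2 * (k ⊓ n))    ≤⟨ ^-monoʳ-≤ 2 (*-monoʳ-≤ 2 (m⊓n≤m k n)) ⟩
  2 ^ (2 * k)          ≡⟨ ^-*-assoc 2 2 k ⟨
  4 ^ k                ∎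
  where open ≤-Reasoning

budget≤2n : ∀ k n → budget k n ≤ 2 * n
budget≤2n k n = ≤-trans (≤-reflexive (budget≡ k n)) (*-monoʳ-≤ 2 (m⊓n≤n k n))

-- The running time and the decision

program : Program
program = record { bodies = bodies ; main = mainB }

opaque
  mainSize : ℕ
  mainSize = exprSize mainB

  main-sound : ∀ w {Q} → wp mainB (w ∷ []) 0 Q →
               ∃[ v ] ∃[ m ] ∃[ t ] Run program w v t × t ≤ mainSize + m * K × Q v m
  main-sound w h
    with v , m , t , run , t≤ , q ← wp-sound mainB (w ∷ []) 0 h
    = v , m , t , run , ≤-trans (≤-reflexive (sym (+-identityʳ t))) t≤ , q

-- The bound on the number of calls in terms of the input size, for k = 0.
callBound : ℕ → ℕ
callBound N = (1 + 2 * N + 2 * N) * solveUnit (11 + N) (1 + 4 * N)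
            + (budgetCost N N + (1 + 2 * N + (1 + 3 * N)))

-- Opaque, since its numeric coefficients must never be normalised.
opaque
  timeBound : ℕ → ℕ
  timeBound N = mainSize + callBound N * K

  timeBound-poly : Polynomial timeBound
  timeBound-poly = poly-+ (poly-const mainSize) (poly-* calls (poly-const K))
    where
    linear : ∀ a b → Polynomial (λ N → a + b * N)
    linear a b = poly-+ (poly-const a) (poly-* (poly-const b) poly-id)
    calls : Polynomial callBound
    calls = poly-+
      (poly-* (poly-+ (linear 1 2) (poly-* (poly-const 2) poly-id))
              (solveUnit-poly (poly-+ (poly-const 11) poly-id) (linear 1 4)))
      (poly-+ (poly-+ (poly-const 1) (poly-* poly-id (poly-+ (poly-const 1) poly-id)))
              (poly-+ (linear 1 2) (linear 1 3)))

  time≤ : ∀ {t m} N k → t ≤ mainSize + m * K → m ≤ callBound N * 4 ^ k → t ≤ timeBound N * 4 ^ k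
  time≤ {t} {m} N k t≤ m≤ = begin
    t                                               ≤⟨ t≤ ⟩
    mainSize + m * K                                ≤⟨ +-monoʳ-≤ mainSize (*-monoˡ-≤ K m≤) ⟩
    mainSize + callBound N * 4 ^ k * K              ≤⟨ +-monoˡ-≤ (callBound N * 4 ^ k * K)
                                                         (m≤m*n mainSize (4 ^ k) {{m^n≢0 4 k}}) ⟩
    mainSize * 4 ^ k + callBound N * 4 ^ k * K      ≡⟨ arith mainSize (4 ^ k) (callBound N) K ⟩
    (mainSize + callBound N * K) * 4 ^ k            ∎
    where
    open ≤-Reasoning
    arith : ∀ e q c k → e * q + c * q * k ≡ (e + c * k) * q
    arith = solve-∀

module Nonnegative (Φ : CNF) (ps : Is2CNF Φ) (k : ℕ) where

  N n r : ℕ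
  N = size (encodeInstance Φ (ℤ.+ k))
  n = length Φ
  r = budget k n

  Φ≤N : size (encodeCNF Φ) ≤ N
  Φ≤N = ≤-trans (m≤m+n _ _) (n≤1+n _)

  n≤N : n ≤ N
  n≤N = ≤-trans (length≤size (encodeList encodeLiteral) Φ) Φ≤N

  bits≤N : bits (ℕᵇ.fromℕ k) ≤ N
  bits≤N = ≤-trans (bits≤size (ℕᵇ.fromℕ k)) (≤-trans (m≤n+m _ 4)
    (m≤n+m _ (1 + size (encodeCNF Φ))))

  ss : All (All (Small N)) Φ
  ss = all-small Φ Φ≤N

  G : List (Edge (11 + N))
  G = edgesOf Φ ps ss

  U : List (Node (11 + N))
  U = map proj₂ G

  length-G : length G ≡ 2 * n
  length-G = length-edgesOf Φ ps ss

  length-U : length U ≡ 2 * n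
  length-U = trans (length-map proj₂ G) length-G

  -- Two nodes and two edges for each clause, and `⊤node` as the only element of the initial `L`.
  lengths≤ : length U + (1 + length G) ≤ 1 + 4 * N
  lengths≤ = begin
    length U + (1 + length G)    ≡⟨ cong₂ (λ u g → u + (1 + g)) length-U length-G ⟩
    2 * n + (1 + 2 * n)          ≡⟨ arith n ⟩
    1 + 4 * n                    ≤⟨ s≤s (*-monoʳ-≤ 4 n≤N) ⟩
    1 + 4 * N                    ∎
    where
    open ≤-Reasoning
    arith : ∀ n → 2 * n + (1 + 2 * n) ≡ 1 + 4 * n
    arith = solve-∀

  solves : Solves (1 + 4 * N) U r G (⊤node ∷ [])
  solves = solve-computes (suc (length U + r)) U r G (⊤node ∷ []) ≤-refl lengths≤
    (λ S _ → edgesOf-symmetric Φ ps ss S)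
    (edgesOf-covered Φ ps ss (All.tabulate (∈-map⁺ proj₂)))

  budget-k-computes : Computes budgetF (cons (encodeℕ k) (encodeCNF Φ)) (encodeUnary r) (budgetCost N n)
  budget-k-computes = subst (λ j → Computes budgetF (cons (encodeℕ k) (encodeCNF Φ)) (encodeUnary (budget j n))
                                            (budgetCost N n))
    (ℕᵇ.toℕ-fromℕ k) (budget-computes (ℕᵇ.fromℕ k) Φ bits≤N)

  calls : ℕ
  calls = solveCost (11 + N) (1 + 4 * N) (length U) r
        + (budgetCost N n + (1 + length G + (1 + 3 * n + 0)))

  calls≤ : calls ≤ callBound N * 4 ^ k
  calls≤ = begin
    calls                                                              ≤⟨ +-mono-≤ solve≤ rest≤ ⟩
    (1 + 2 * N + 2 * N) * (4 ^ k * Y) + rest                           ≤⟨ +-monoʳ-≤ _ (m≤m*n rest (4 ^ k) {{m^n≢0 4 k}}) ⟩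
    (1 + 2 * N + 2 * N) * (4 ^ k * Y) + rest * 4 ^ k                   ≡⟨ arith (1 + 2 * N + 2 * N) (4 ^ k) Y rest ⟩
    ((1 + 2 * N + 2 * N) * Y + rest) * 4 ^ k                           ∎
    where
    open ≤-Reasoning
    Y rest : ℕ
    Y = solveUnit (11 + N) (1 + 4 * N)
    rest = budgetCost N N + (1 + 2 * N + (1 + 3 * N))
    arith : ∀ a q y r → a * (q * y) + r * q ≡ (a * y + r) * q
    arith = solve-∀
    solve≤ : solveCost (11 + N) (1 + 4 * N) (length U) r ≤ (1 + 2 * N + 2 * N) * (4 ^ k * Y)
    solve≤ = ≤-trans (solveCost-bound {u = length U} {r = r})
      (*-mono-≤ (+-mono-≤ (s≤s (≤-trans (≤-reflexive length-U) (*-monoʳ-≤ 2 n≤N)))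
                          (≤-trans (budget≤2n k n) (*-monoʳ-≤ 2 n≤N)))
                (*-monoˡ-≤ Y (2^budget≤4^k k n)))
    rest≤ : budgetCost N n + (1 + length G + (1 + 3 * n + 0)) ≤ rest
    rest≤ = +-mono-≤ (s≤s (*-monoˡ-≤ (1 + N) n≤N))
      (+-mono-≤ (s≤s (≤-trans (≤-reflexive length-G) (*-monoʳ-≤ 2 n≤N)))
                (≤-trans (≤-reflexive (+-identityʳ (1 + 3 * n))) (s≤s (*-monoʳ-≤ 3 n≤N))))

  runs : ∀ {b} → Computes solveF
                   (cons (encodeNodes U) (cons (encodeUnary r) (cons (encodeEdges G) (encodeNodes (⊤node {N} ∷ [])))))
                   (encodeBool b) (solveCost (11 + N) (1 + 4 * N) (length U) r) →
         ∃[ v ] ∃[ m ] ∃[ t ] Run program (encodeInstance Φ (ℤ.+ k)) v t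
           × t ≤ mainSize + m * K × v ≡ encodeBool b × m ≤ calls
  runs s = main-sound (encodeInstance Φ (ℤ.+ k))
    (edges-computes Φ ps ss ▸ heads-computes G ▸ budget-k-computes ▸ s ▸ refl , ≤-refl)

  decides : ∃[ b ] ∃[ t ]
    Run program (encodeInstance Φ (ℤ.+ k)) (encodeBool b) t
    × Reflects (SatisfiableByDeleting Φ (ℤ.+ k)) b
    × t ≤ timeBound N * 4 ^ k
  decides
    with b , s , reflects ← solves
    with _ , _ , t , run , t≤ , refl , m≤ ← runs {b} s
    = b , t , run ,
      map-Reflects (proj₁ (feasible⇔deletable Φ ps ss k)) (proj₂ (feasible⇔deletable Φ ps ss k)) reflects ,
      time≤ N k t≤ (≤-trans m≤ calls≤)

nonempty : ∀ t → 1 ≤ size t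
nonempty nil        = s≤s z≤n
nonempty (cons _ _) = s≤s z≤n

Decides : CNF → ℤ → ℕ → Set
Decides Φ k τ = ∃[ b ] ∃[ t ]
  Run program (encodeInstance Φ k) (encodeBool b) t × Reflects (SatisfiableByDeleting Φ k) b × t ≤ τ

decides : (Φ : CNF) → Is2CNF Φ → (k : ℤ) →
          Decides Φ k (timeBound (size (encodeInstance Φ k)) * 4 ^ ∣ k ⊔ 0ℤ ∣)
decides Φ ps (ℤ.+ k) =
  subst (λ j → Decides Φ (ℤ.+ k) (timeBound (size (encodeInstance Φ (ℤ.+ k))) * 4 ^ j))
        (sym (⊔-identityʳ k)) (Nonnegative.decides Φ ps k)
-- A negative `k` is rejected after reading its sign, without any call, and the exponential factor
-- of the bound is `4 ^ 0`.
decides Φ ps -[1+ k ]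
  with v , m , t , run , t≤ , refl , m≤0 ←
    main-sound (encodeInstance Φ -[1+ k ]) {λ v m → v ≡ nil × m ≤ 0} (refl , z≤n)
  = false , t , run , ofⁿ (λ { (_ , () , _) }) ,
    time≤ (size (encodeInstance Φ -[1+ k ])) 0 t≤ (≤-trans m≤0 z≤n)

mainTheorem11 : ∃[ P ] ∃[ c ] ∃[ d ]
    ((Φ : CNF) → Is2CNF Φ → (k : ℤ) →
    ∃[ b ] ∃[ t ]
    Run P (encodeInstance Φ k) (encodeBool b) t
    × Reflects (SatisfiableByDeleting Φ k) b
    × t ≤ c * size (encodeInstance Φ k) ^ d * 4 ^ ∣ k ⊔ 0ℤ ∣)
mainTheorem11 = let c , d , poly = timeBound-poly in program , c , d , λ Φ ps k →
  let b , t , run , reflects , t≤ = decides Φ ps k in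
  b , t , run , reflects ,
  ≤-trans t≤ (*-monoˡ-≤ (4 ^ ∣ k ⊔ 0ℤ ∣) (poly (size (encodeInstance Φ k)) (nonempty (encodeInstance Φ k))))
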